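{- Let $G=(V,E)$ be a graph with $n=|E|$ edges and maximum degree $\deg(G)$, and let $\ell:V\to\{0,1\}$ be a vertex labelling with $\sum_{v\in V}\ell(v)$ odd. Then the Tseitin formula of $(G,\ell)$ has a Stabbing Planes refutation of size $2^{O(\log^2 n)+\deg(G)}$ and depth $O(\deg(G)\cdot\log^2 n)$, where the constants hidden in the $O(\cdot)$ are absolute.
   Context: Tseitin formula: for a graph $G=(V,E)$ and $\ell:V\to\{0,1\}$, introduce a variable $x_e$ for each edge $e\in E$ and, for each vertex $v$, the $\mathbb{F}_2$-linear equation $\bigoplus_{u:uv\in E}x_{uv}=\ell(v)$. It is written as a CNF formula by encoding each vertex equation as the conjunction of the clauses over the incident edge variables that rule out each violating assignment (at most $|V|\cdot 2^{\deg(G)-1}$ clauses in total, for $\deg(G)\ge 1$). It is unsatisfiable when $\sum_{v}\ell(v)$ is odd. Encoding of CNFs: a CNF formula is translated to a system of linear inequalities by including $0\le x_i\le 1$ for every variable $x_i$, and for every clause $\bigvee_{i\in I}x_i\vee\bigvee_{j\in J}\neg x_j$ the inequality $\sum_{i\in I}x_i+\sum_{j\in J}(1-x_j)\ge 1$. A Stabbing Planes refutation of a CNF is a refutation of this system. Stabbing Planes (SP): let $Ax\ge b$ be a system of integer linear inequalities in real variables with no integer solution ("unsatisfiable"). An SP refutation of it is a directed binary tree whose edges are labelled by integer linear inequalities such that: (internal nodes) if the right outgoing edge of an internal node is labelled $cx\ge d$ (with $c$ an integer vector and $d$ an integer), then its left outgoing edge is labelled $cx\le d-1$ (the pair is the query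 of the node); (leaves) each leaf is labelled with a conic (nonnegative) combination of inequalities of $Ax\ge b$ and of inequalities labelling the path from the root to that leaf which yields $0\ge 1$. The depth is the length of the longest root-to-leaf path; the size is the bit-length needed to encode the whole tree (polynomially equivalent, for CNF formulas, to the number of queries). -}

module Defs where

open import Data.Bool.Base using (Bool; true; false; if_then_else_; _xor_)
open import Data.Bool.Properties using () renaming (_≟_ to _≟ᵇ_)
open import Data.Fin.Base using (Fin)
open import Data.Fin.Subset using (Subset; ∣_∣)
open import Data.Fin.Subset.Properties using (_∈?_)
open import Data.Integer.Base as ℤ using (ℤ; +_)
open import Data.List.Base using (List; []; _∷_; _++_; map; foldr; filter; concatMap; allFin; length)
open import Data.List.Extrema.Nat using (max)
open import Data.List.Membership.Propositional using () renaming (_∈_ to _∈ₗ_)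
open import Data.List.Relation.Unary.All using (All)
open import Data.Nat.Base using (ℕ; suc; _+_; _*_; _^_; _≤_; _⊔_; _%_)
open import Data.Nat.ListAction using (sum)
open import Data.Nat.Logarithm using (⌊log₂_⌋)
open import Data.Product.Base using (_×_; _,_; proj₁; proj₂; ∃-syntax)
open import Data.Rational.Base as ℚ using (ℚ; 0ℚ; 1ℚ; ↥_; ↧ₙ_)
open import Data.Vec.Base as Vec using (Vec; lookup; replicate; _[_]%=_; _[_]≔_)
open import Function.Base using (_∘_)
open import Function.Definitions using (Injective)
open import Relation.Binary.PropositionalEquality.Core using (_≡_)
open import Relation.Nullary.Decidable using (¬?)

private
  variable
    n : ℕ

------------------------------------------------------------------------
-- Asymptotics

infix 4 _∈O_

_∈O_ : (ℕ → ℕ) → (ℕ → ℕ) → Set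
f ∈O g = ∃[ C ] ∃[ N ] ∀ n → N ≤ n → f n ≤ C * g n

-- For n ≥ 2, rounding down changes log² n by at most a factor of 4.
log² : ℕ → ℕ
log² n = ⌊log₂ n ⌋ ^ 2

------------------------------------------------------------------------
-- Graphs

-- Finite simple undirected graphs: an edge is a two-element set of
-- vertices, and distinct edges are distinct sets.
record Graph : Set where
  field
    ∣V∣            : ℕ
    ∣E∣            : ℕ
    ends           : Fin ∣E∣ → Subset ∣V∣
    ends-two       : ∀ e → ∣ ends e ∣ ≡ 2
    ends-injective : Injective _≡_ _≡_ ends

  incident : Fin ∣V∣ → List (Fin ∣E∣)
  incident v = filter (λ e → v ∈? ends e) (allFin ∣E∣)

  degree : Fin ∣V∣ → ℕ
  degree v = length (incident v)

  maxDegree : ℕ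
  maxDegree = max 0 (map degree (allFin ∣V∣))

  Labelling : Set
  Labelling = Fin ∣V∣ → Bool

open Graph public

toBit : Bool → ℕ
toBit b = if b then 1 else 0

OddSum : (G : Graph) → Labelling G → Set
OddSum G ℓ = sum (map (toBit ∘ ℓ) (allFin (∣V∣ G))) % 2 ≡ 1

------------------------------------------------------------------------
-- CNF formulas over the variables Fin n

data Literal (n : ℕ) : Set where
  pos neg : Fin n → Literal n

Clause : ℕ → Set
Clause n = List (Literal n)

CNF : ℕ → Set
CNF n = List (Clause n)

-- A partial assignment, as the list of the variables it sets together with
-- their values.
Assignment : ℕ → Set
Assignment n = List (Fin n × Bool)

assignments : List (Fin n) → List (Assignment n)
assignments []       = [] ∷ []
assignments (x ∷ xs) =
  map ((x , false) ∷_) (assignments xs) ++ map ((x , true) ∷_) (assignments xs)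

parity : Assignment n → Bool
parity α = foldr _xor_ false (map proj₂ α)

-- The clause falsified exactly by the assignments extending α.
ruleOut : Assignment n → Clause n
ruleOut = map (λ (x , b) → if b then neg x else pos x)

vertexClauses : (G : Graph) → Labelling G → Fin (∣V∣ G) → CNF (∣E∣ G)
vertexClauses G ℓ v =
  map ruleOut (filter (λ α → ¬? (parity α ≟ᵇ ℓ v)) (assignments (incident G v)))

tseitin : (G : Graph) → Labelling G → CNF (∣E∣ G)
tseitin G ℓ = concatMap (vertexClauses G ℓ) (allFin (∣V∣ G))

------------------------------------------------------------------------
-- Integer linear inequalities

-- c ·x≥ d is the inequality Σᵢ cᵢ xᵢ ≥ d.
infix 5 _·x≥_

record LinIneq (n : ℕ) : Set where
  constructor _·x≥_
  field
    coeffs : Vec ℤ n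
    bound  : ℤ

open LinIneq public

-- c x ≤ d, written as (- c) x ≥ - d.
infix 5 _·x≤_

_·x≤_ : Vec ℤ n → ℤ → LinIneq n
c ·x≤ d = Vec.map ℤ.-_ c ·x≥ (ℤ.- d)

unit : Fin n → Vec ℤ n
unit i = replicate _ (+ 0) [ i ]≔ + 1

-- Adds x i, respectively 1 - x i, to the left-hand side; the constant 1 is
-- moved to the right-hand side.
addLiteral : Literal n → LinIneq n → LinIneq n
addLiteral (pos i) (c ·x≥ d) = c [ i ]%= ℤ.suc  ·x≥ d
addLiteral (neg i) (c ·x≥ d) = c [ i ]%= ℤ.pred ·x≥ ℤ.pred d

clauseIneq : Clause n → LinIneq n
clauseIneq = foldr addLiteral (replicate _ (+ 0) ·x≥ + 1)

boxIneqs : (n : ℕ) → List (LinIneq n)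
boxIneqs n = concatMap (λ i → (unit i ·x≥ + 0) ∷ (unit i ·x≤ + 1) ∷ []) (allFin n)

encode : CNF n → List (LinIneq n)
encode {n} F = boxIneqs n ++ map clauseIneq F

------------------------------------------------------------------------
-- Stabbing Planes

-- A linear combination, as a list of multipliers and inequalities.
Combination : ℕ → Set
Combination n = List (ℚ × LinIneq n)

combine : (LinIneq n → ℤ) → Combination n → ℚ
combine π = foldr (λ (q , I) s → q ℚ.* (π I ℚ./ 1) ℚ.+ s) 0ℚ

Conic : List (LinIneq n) → Combination n → Set
Conic A = All (λ (q , I) → ℚ.NonNegative q × I ∈ₗ A)

Yields0≥1 : Combination n → Set
Yields0≥1 L =
  (∀ i → combine (λ I → lookup (coeffs I) i) L ≡ 0ℚ) × combine bound L ≡ 1ℚ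

-- The index is the system together with the labels on the path from the root
-- of the whole refutation: SP A is the type of refutations of A, and the
-- subtree below an edge is a refutation of the system extended by that
-- edge's label.
data SP {n : ℕ} : List (LinIneq n) → Set where
  leaf  : ∀ {A} (L : Combination n) → Conic A L → Yields0≥1 L → SP A
  query : ∀ {A} (c : Vec ℤ n) (d : ℤ) →
          SP ((c ·x≤ ℤ.pred d) ∷ A) →
          SP ((c ·x≥ d) ∷ A) →
          SP A

depth : {A : List (LinIneq n)} → SP A → ℕ
depth (leaf _ _ _)    = 0
depth (query _ _ l r) = suc (depth l ⊔ depth r)

-- Lengths of binary encodings: one bit for each sign and for each node's
-- kind. Leaves spell out the inequalities they combine; the proofs that a
-- leaf is correct are not part of the tree and are not counted.
bitsℕ : ℕ → ℕ
bitsℕ k = suc ⌊log₂ k ⌋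

bitsℤ : ℤ → ℕ
bitsℤ z = suc (bitsℕ ℤ.∣ z ∣)

bitsℚ : ℚ → ℕ
bitsℚ q = bitsℤ (↥ q) + bitsℕ (↧ₙ q)

bitsIneq : LinIneq n → ℕ
bitsIneq (c ·x≥ d) = Vec.sum (Vec.map bitsℤ c) + bitsℤ d

bitsCombination : Combination n → ℕ
bitsCombination L = sum (map (λ (q , I) → bitsℚ q + bitsIneq I) L)

size : {A : List (LinIneq n)} → SP A → ℕ
size (leaf L _ _)    = suc (bitsCombination L)
size (query c d l r) =
  suc (bitsIneq (c ·x≤ ℤ.pred d) + bitsIneq (c ·x≥ d) + size l + size r)

module Submission where

-- For a list W of vertices let cut W be the set of edges with an odd number
-- of endpoints in W. A path of the refutation fixes the value k of the linear
-- form Σ_{e ∈ cut W} x_e for some W whose total label is not congruent to k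
-- modulo 2; initially W consists of all non-isolated vertices and k = 0.
-- Cutting W into halves W₁ and W₂, binary search fixes the sums over cut W₁
-- and over cut W₁ ∩ cut W₂, and since
--   Σ cut W₂ = Σ cut W + 2 Σ (cut W₁ ∩ cut W₂) − Σ cut W₁
-- holds coefficientwise, the sum over cut W₂ is fixed too and one of the two
-- halves inherits the parity violation. After O(log n) halvings W is a single
-- vertex, where querying all incident edges leaves an assignment that either
-- falsifies a clause or contradicts the value k. The depth is
-- O(log² n) + deg, and every node costs poly(n) bits, which gives the size.

open import Defs
open import Data.Bool.Base using (Bool; true; false; not; _xor_; _∧_)
open import Data.Bool.Properties
  using (¬-not; not-involutive; not-distribˡ-xor; xor-same; xor-comm; xor-assoc; xor-identityʳ; xor-annihilates-not)
  renaming (_≟_ to _≟ᵇ_)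
open import Data.Fin.Base using (Fin; zero; suc)
open import Data.Fin.Properties using (any?)
open import Data.Fin.Subset as Subset using (Subset)
open import Data.Fin.Subset.Properties using (_∈?_)
open import Data.Integer.Base as ℤ using (ℤ; +_; -[1+_]; +[1+_]; ∣_∣)
import Data.Integer.Properties as ℤ
import Data.Integer.Tactic.RingSolver as ℤSolver
open import Data.List.Base using (List; []; _∷_; _++_; map; length; filter; allFin; tabulate; take; drop)
open import Data.List.Extrema.Nat using (xs≤max)
open import Data.List.Membership.Propositional using (_∈_; lose)
open import Data.List.Membership.Propositional.Properties
  using (∈-concatMap⁺; ∈-concatMap⁻; ∈-allFin; ∈-map⁺; ∈-map⁻; ∈-++⁺ˡ; ∈-++⁺ʳ; ∈-++⁻; ∈-filter⁺; ∈-filter⁻)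
open import Data.List.Properties
  using (length-map; length-tabulate; length-filter; length-take; length-drop; map-tabulate; map-++; map-cong; take++drop≡id)
open import Data.List.Relation.Binary.Subset.Propositional using (_⊆_)
open import Data.List.Relation.Unary.All as All using (All; []; _∷_)
import Data.List.Relation.Unary.All.Properties as All
open import Data.List.Relation.Unary.Any using (here; there; satisfied)
open import Data.Nat.Base hiding (parity)
import Data.Nat.Coprimality as Coprime
open import Data.Nat.ListAction using (sum)
open import Data.Nat.ListAction.Properties using (sum-++)
open import Data.Nat.Logarithm using (⌊log₂_⌋; ⌊log₂⌋-mono-≤; ⌊log₂[2^n]⌋≡n)
open import Data.Nat.Properties
import Data.Nat.Tactic.RingSolver as ℕSolver
open import Data.Product.Base using (Σ-syntax; ∃-syntax; _×_; _,_; proj₁; proj₂)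
open import Data.Rational.Base as ℚ using (ℚ; mkℚ)
import Data.Rational.Properties as ℚ
open import Data.Sum.Base using (inj₁; inj₂)
open import Data.Vec.Base as Vec using (Vec; []; _∷_; lookup)
open import Data.Vec.Properties using (lookup-map; lookup∘tabulate; lookup-replicate)
open import Function.Base using (_∘_; id)
open import Level using (Level)
open import Relation.Binary.PropositionalEquality
  using (_≡_; _≢_; refl; sym; trans; cong; cong₂; subst; module ≡-Reasoning)
open import Relation.Nullary using (Dec; ¬_; yes; no; does; contradiction)
open import Relation.Nullary.Decidable using (¬?; _×-dec_)
open import Relation.Unary using (Decidable)

private
  variable
    n : ℕ
    a p : Level
    X Y : Set a
    P : X → Set p
    A : List (LinIneq n)

-- Powers of two and the binary logarithm.

m<2^m : ∀ m → m < 2 ^ m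
m<2^m zero    = s≤s z≤n
m<2^m (suc m) = begin-strict
  suc m            <⟨ +-mono-≤-< (m^n>0 2 m) (m<2^m m) ⟩
  2 ^ m + 2 ^ m    ≡⟨ cong (_+_ (2 ^ m)) (+-identityʳ (2 ^ m)) ⟨
  2 ^ suc m        ∎
  where open ≤-Reasoning

⌊log₂m⌋≤m : ∀ m → ⌊log₂ m ⌋ ≤ m
⌊log₂m⌋≤m m = begin
  ⌊log₂ m ⌋        ≤⟨ ⌊log₂⌋-mono-≤ (<⇒≤ (m<2^m m)) ⟩
  ⌊log₂ 2 ^ m ⌋    ≡⟨ ⌊log₂[2^n]⌋≡n m ⟩
  m                ∎
  where open ≤-Reasoning

m<2^[1+⌊log₂m⌋] : ∀ m → m < 2 ^ suc ⌊log₂ m ⌋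
m<2^[1+⌊log₂m⌋] m = ≰⇒> λ 2^≤m → 1+n≰n (begin
  suc ⌊log₂ m ⌋                ≡⟨ ⌊log₂[2^n]⌋≡n (suc ⌊log₂ m ⌋) ⟨
  ⌊log₂ 2 ^ suc ⌊log₂ m ⌋ ⌋    ≤⟨ ⌊log₂⌋-mono-≤ 2^≤m ⟩
  ⌊log₂ m ⌋                    ∎)
  where open ≤-Reasoning

-- Parity of naturals and integers.

odd : ℕ → Bool
odd zero    = false
odd (suc n) = not (odd n)

-- Negation preserves parity, so the absolute value can stand for the integer.
oddℤ : ℤ → Bool
oddℤ i = odd ∣ i ∣

odd-+ : ∀ m n → odd (m + n) ≡ odd m xor odd n
odd-+ zero    n = refl
odd-+ (suc m) n = trans (cong not (odd-+ m n)) (not-distribˡ-xor (odd m) (odd n))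

odd-+-self : ∀ m → odd (m + m) ≡ false
odd-+-self m = trans (odd-+ m m) (xor-same (odd m))

odd-toBit : ∀ b → odd (toBit b) ≡ b
odd-toBit false = refl
odd-toBit true  = refl

%2≡1⇒odd : ∀ m → m % 2 ≡ 1 → odd m ≡ true
%2≡1⇒odd (suc zero)    _ = refl
%2≡1⇒odd (suc (suc m)) p = trans (not-involutive (odd m)) (%2≡1⇒odd m p)

oddℤ-⊖ : ∀ m n → oddℤ (m ℤ.⊖ n) ≡ odd m xor odd n
oddℤ-⊖ zero    zero    = refl
oddℤ-⊖ zero    (suc n) = refl
oddℤ-⊖ (suc m) zero    = sym (xor-identityʳ (odd (suc m)))
oddℤ-⊖ (suc m) (suc n) = begin
  oddℤ (suc m ℤ.⊖ suc n)     ≡⟨ cong oddℤ (ℤ.[1+m]⊖[1+n]≡m⊖n m n) ⟩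
  oddℤ (m ℤ.⊖ n)             ≡⟨ oddℤ-⊖ m n ⟩
  odd m xor odd n            ≡⟨ xor-annihilates-not (odd m) (odd n) ⟨
  odd (suc m) xor odd (suc n) ∎
  where open ≡-Reasoning

oddℤ-+ : ∀ i j → oddℤ (i ℤ.+ j) ≡ oddℤ i xor oddℤ j
oddℤ-+ (+ m)    (+ n)    = odd-+ m n
oddℤ-+ (+ m)    -[1+ n ] = oddℤ-⊖ m (suc n)
oddℤ-+ -[1+ m ] (+ n)    = trans (oddℤ-⊖ n (suc m)) (xor-comm (odd n) (odd (suc m)))
oddℤ-+ -[1+ m ] -[1+ n ] = begin
  not (not (odd (m + n)))     ≡⟨ not-involutive _ ⟩
  odd (m + n)                 ≡⟨ odd-+ m n ⟩
  odd m xor odd n             ≡⟨ xor-annihilates-not (odd m) (odd n) ⟨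
  odd (suc m) xor odd (suc n) ∎
  where open ≡-Reasoning

oddℤ-neg : ∀ i → oddℤ (ℤ.- i) ≡ oddℤ i
oddℤ-neg i = cong odd (ℤ.∣-i∣≡∣i∣ i)

-- Combinations with natural multipliers.

-- All leaves below use natural multipliers, so their arithmetic stays in ℤ and passes to ℚ only
-- through `rational`.
Weighted : ℕ → Set
Weighted n = List (ℕ × LinIneq n)

total : (LinIneq n → ℤ) → Weighted n → ℤ
total π []            = + 0
total π ((k , I) ∷ L) = + k ℤ.* π I ℤ.+ total π L

coeff : Fin n → LinIneq n → ℤ
coeff i I = lookup (coeffs I) i

ℤ⇒ℚ : ℤ → ℚ
ℤ⇒ℚ i = i ℚ./ 1

-- The quotient `i / 1` is normalised through a gcd that is stuck on a variable `i`; the explicit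
-- fraction lets products, sums and bit lengths compute.
ℤ⇒ℚ≡mkℚ : ∀ i → ℤ⇒ℚ i ≡ mkℚ i 0 (Coprime.sym (Coprime.1-coprimeTo ∣ i ∣))
ℤ⇒ℚ≡mkℚ i = ℚ.↥p/↧p≡p (mkℚ i 0 (Coprime.sym (Coprime.1-coprimeTo ∣ i ∣)))

ℤ⇒ℚ-*-+ : ∀ i j k → ℤ⇒ℚ i ℚ.* ℤ⇒ℚ j ℚ.+ ℤ⇒ℚ k ≡ ℤ⇒ℚ (i ℤ.* j ℤ.+ k)
ℤ⇒ℚ-*-+ i j k = begin
  ℤ⇒ℚ i ℚ.* ℤ⇒ℚ j ℚ.+ ℤ⇒ℚ k    ≡⟨ cong₂ (λ p q → p ℚ.* q ℚ.+ ℤ⇒ℚ k) (ℤ⇒ℚ≡mkℚ i) (ℤ⇒ℚ≡mkℚ j) ⟩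
  ℤ⇒ℚ (i ℤ.* j) ℚ.+ ℤ⇒ℚ k      ≡⟨ cong₂ ℚ._+_ (ℤ⇒ℚ≡mkℚ (i ℤ.* j)) (ℤ⇒ℚ≡mkℚ k) ⟩
  ℤ⇒ℚ (i ℤ.* j ℤ.* + 1 ℤ.+ k ℤ.* + 1) ≡⟨ cong ℤ⇒ℚ (cong₂ ℤ._+_ (ℤ.*-identityʳ (i ℤ.* j)) (ℤ.*-identityʳ k)) ⟩
  ℤ⇒ℚ (i ℤ.* j ℤ.+ k)          ∎
  where open ≡-Reasoning

rational : Weighted n → Combination n
rational = map λ (k , I) → ℤ⇒ℚ (+ k) , I

combine-rational : ∀ (π : LinIneq n → ℤ) L → combine π (rational L) ≡ ℤ⇒ℚ (total π L)
combine-rational π []            = refl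
combine-rational π ((k , I) ∷ L) =
  trans (cong (ℚ._+_ (ℤ⇒ℚ (+ k) ℚ.* ℤ⇒ℚ (π I))) (combine-rational π L)) (ℤ⇒ℚ-*-+ (+ k) (π I) (total π L))

-- Bit lengths of inequalities and combinations.

bitsℕ≤ : ∀ k → bitsℕ k ≤ suc k
bitsℕ≤ k = s≤s (⌊log₂m⌋≤m k)

bitsℚ≤ : ∀ k → bitsℚ (ℤ⇒ℚ (+ k)) ≤ k + 3
bitsℚ≤ k rewrite ℤ⇒ℚ≡mkℚ (+ k) = begin
  suc (bitsℕ k) + 1  ≤⟨ +-monoˡ-≤ 1 (s≤s (bitsℕ≤ k)) ⟩
  suc (suc k) + 1    ≡⟨ +-suc (suc (suc k)) 0 ⟩
  suc (suc (suc k)) + 0 ≡⟨ trans (+-identityʳ _) (+-comm 3 k) ⟩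
  k + 3              ∎
  where open ≤-Reasoning

Small : ℕ → LinIneq n → Set
Small K I = (∀ i → ∣ coeff i I ∣ ≤ K) × ∣ bound I ∣ ≤ K

-- Linear instead of logarithmic in `K`: crude, but `K` will be polynomial in the number of edges,
-- so only a lower-order term of the size exponent is affected.
bitsℤ≤ : ∀ {K} i → ∣ i ∣ ≤ K → bitsℤ i ≤ 2 + K
bitsℤ≤ i ∣i∣≤K = s≤s (≤-trans (bitsℕ≤ ∣ i ∣) (s≤s ∣i∣≤K))

bitsIneq≤ : ∀ {K} (I : LinIneq n) → Small K I → bitsIneq I ≤ suc n * (2 + K)
bitsIneq≤ {n = n} {K = K} (c ·x≥ d) (c≤K , d≤K) = begin
  Vec.sum (Vec.map bitsℤ c) + bitsℤ d  ≤⟨ +-mono-≤ (go c c≤K) (bitsℤ≤ d d≤K) ⟩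
  n * (2 + K) + (2 + K)                ≡⟨ +-comm (n * (2 + K)) (2 + K) ⟩
  suc n * (2 + K)                      ∎
  where
  open ≤-Reasoning
  go : ∀ {m} (c : Vec ℤ m) → (∀ i → ∣ lookup c i ∣ ≤ K) → Vec.sum (Vec.map bitsℤ c) ≤ m * (2 + K)
  go []      _   = z≤n
  go (z ∷ c) c≤K = +-mono-≤ (bitsℤ≤ z (c≤K zero)) (go c (c≤K ∘ suc))

bitsCombination≤ : ∀ {K M} (L : Weighted n) →
                   All (λ (k , I) → k ≤ M × Small K I) L →
                   bitsCombination (rational L) ≤ length L * (M + 3 + suc n * (2 + K))
bitsCombination≤ []            []                    = z≤n
bitsCombination≤ ((k , I) ∷ L) ((k≤M , small) ∷ all) =
  +-mono-≤ (+-mono-≤ (≤-trans (bitsℚ≤ k) (+-monoˡ-≤ 3 k≤M)) (bitsIneq≤ I small)) (bitsCombination≤ L all)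

-- Needed for the multiplier `m` in `conflict⁺`, which is one less than the total bound of its
-- combination.
∣total∣≤ : ∀ {K M} (L : Weighted n) →
           All (λ (k , I) → k ≤ M × Small K I) L → ∣ total bound L ∣ ≤ length L * (M * K)
∣total∣≤ []            []                    = z≤n
∣total∣≤ ((k , I) ∷ L) ((k≤M , small) ∷ all) = begin
  ∣ + k ℤ.* bound I ℤ.+ total bound L ∣      ≤⟨ ℤ.∣i+j∣≤∣i∣+∣j∣ (+ k ℤ.* bound I) _ ⟩
  ∣ + k ℤ.* bound I ∣ + ∣ total bound L ∣    ≡⟨ cong (_+ _) (ℤ.abs-* (+ k) (bound I)) ⟩
  k * ∣ bound I ∣ + ∣ total bound L ∣        ≤⟨ +-mono-≤ (*-mono-≤ k≤M (proj₂ small)) (∣total∣≤ L all) ⟩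
  _                                          ∎
  where open ≤-Reasoning

-- Refutations of bounded depth and size.

-- The size bound is arranged so that it adds up over the two children of a
-- query.
Refutes : (c : ℕ) → ℕ → List (LinIneq n) → Set
Refutes c D A = Σ[ P ∈ SP A ] depth P ≤ D × size P + c ≤ c * 2 ^ suc D

refutes-query : ∀ {c D} (v : Vec ℤ n) d →
  suc (bitsIneq (v ·x≤ ℤ.pred d) + bitsIneq (v ·x≥ d)) ≤ c →
  Refutes c D ((v ·x≤ ℤ.pred d) ∷ A) → Refutes c D ((v ·x≥ d) ∷ A) → Refutes c (suc D) A
refutes-query {c = c} {D} v d bits≤c (P , dP , sP) (Q , dQ , sQ) =
  query v d P Q , s≤s (⊔-lub dP dQ) , (begin
    suc b + size P + size Q + c      ≤⟨ +-monoˡ-≤ c (+-monoˡ-≤ (size Q) (+-monoˡ-≤ (size P) bits≤c)) ⟩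
    c + size P + size Q + c          ≡⟨ regroup c (size P) (size Q) ⟩
    (size P + c) + (size Q + c)      ≤⟨ +-mono-≤ sP sQ ⟩
    c * 2 ^ suc D + c * 2 ^ suc D    ≡⟨ double c (2 ^ suc D) ⟩
    c * 2 ^ suc (suc D)              ∎)
  where
  open ≤-Reasoning
  b : ℕ
  b = bitsIneq (v ·x≤ ℤ.pred d) + bitsIneq (v ·x≥ d)
  regroup : ∀ c p q → c + p + q + c ≡ (p + c) + (q + c)
  regroup = ℕSolver.solve-∀
  double : ∀ c x → c * x + c * x ≡ c * (2 * x)
  double = ℕSolver.solve-∀

refutes-leaf : ∀ {c D} (L : Combination n) → Conic A L → Yields0≥1 L →
               suc (bitsCombination L) ≤ c → Refutes c D A
refutes-leaf {c = c} {D} L conic yields bits≤c = leaf L conic yields , z≤n , (begin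
  suc (bitsCombination L) + c  ≤⟨ +-monoˡ-≤ c bits≤c ⟩
  c + c                        ≡⟨ cong (_+_ c) (+-identityʳ c) ⟨
  2 * c                        ≡⟨ *-comm 2 c ⟩
  c * 2                        ≤⟨ *-monoʳ-≤ c (*-monoʳ-≤ 2 (m^n>0 2 D)) ⟩
  c * 2 ^ suc D                ∎)
  where open ≤-Reasoning

-- Finite sums and linear forms with coefficients 0 and 1.

∑ : (Fin n → ℤ) → ℤ
∑ {zero}  f = + 0
∑ {suc n} f = f zero ℤ.+ ∑ (f ∘ suc)

∑-cong : ∀ {f g : Fin n → ℤ} → (∀ i → f i ≡ g i) → ∑ f ≡ ∑ g
∑-cong {zero}  f≗g = refl
∑-cong {suc n} f≗g = cong₂ ℤ._+_ (f≗g zero) (∑-cong (f≗g ∘ suc))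

∑-zero : ∀ n → ∑ {n} (λ _ → + 0) ≡ + 0
∑-zero zero    = refl
∑-zero (suc n) = trans (ℤ.+-identityˡ _) (∑-zero n)

∑-unit : ∀ (f : Fin n → ℤ) j → ∑ (λ i → f i ℤ.* lookup (unit i) j) ≡ f j
∑-unit {suc n} f zero = begin
  f zero ℤ.* + 1 ℤ.+ ∑ (λ i → f (suc i) ℤ.* + 0)
    ≡⟨ cong₂ ℤ._+_ (ℤ.*-identityʳ (f zero)) (trans (∑-cong (λ i → ℤ.*-zeroʳ (f (suc i)))) (∑-zero n)) ⟩
  f zero ℤ.+ + 0                                  ≡⟨ ℤ.+-identityʳ (f zero) ⟩
  f zero                                          ∎
  where open ≡-Reasoning
∑-unit {suc n} f (suc j) = begin
  f zero ℤ.* lookup (Vec.replicate n (+ 0)) j ℤ.+ ∑ (λ i → f (suc i) ℤ.* lookup (unit i) j)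
    ≡⟨ cong₂ ℤ._+_ (trans (cong (f zero ℤ.*_) (lookup-replicate j (+ 0))) (ℤ.*-zeroʳ (f zero))) (∑-unit (f ∘ suc) j) ⟩
  + 0 ℤ.+ f (suc j)
    ≡⟨ ℤ.+-identityˡ (f (suc j)) ⟩
  f (suc j) ∎
  where open ≡-Reasoning

total-tabulate : ∀ {m} (π : LinIneq n → ℤ) (g : Fin m → ℕ × LinIneq n) →
                 total π (tabulate g) ≡ ∑ (λ i → + proj₁ (g i) ℤ.* π (proj₂ (g i)))
total-tabulate {m = zero}  π g = refl
total-tabulate {m = suc m} π g = cong (ℤ._+_ (+ proj₁ (g zero) ℤ.* π (proj₂ (g zero)))) (total-tabulate π (g ∘ suc))

form : (Fin n → Bool) → Vec ℤ n
form p = Vec.tabulate λ i → + toBit (p i)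

coeff-≥ : ∀ (p : Fin n → Bool) k i → coeff i (form p ·x≥ k) ≡ + toBit (p i)
coeff-≥ p k i = lookup∘tabulate _ i

coeff-≤ : ∀ (p : Fin n → Bool) k i → coeff i (form p ·x≤ k) ≡ ℤ.- (+ toBit (p i))
coeff-≤ p k i = trans (lookup-map i ℤ.-_ (form p)) (cong ℤ.-_ (lookup∘tabulate _ i))

∑-toBit : ∀ (p : Fin n → Bool) → Σ[ s ∈ ℕ ] ∑ (λ i → + toBit (p i)) ≡ + s × s ≤ n
∑-toBit {zero}  p = 0 , refl , z≤n
∑-toBit {suc n} p with p zero | ∑-toBit (p ∘ suc)
... | false | s , eq , s≤n = s , trans (ℤ.+-identityˡ _) eq , m≤n⇒m≤1+n s≤n
... | true  | s , eq , s≤n = suc s , cong (ℤ._+_ (+ 1)) eq , s≤s s≤n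

∑-neg : ∀ (f : Fin n → ℤ) → ∑ (λ i → ℤ.- f i) ≡ ℤ.- ∑ f
∑-neg {zero}  f = refl
∑-neg {suc n} f = trans (cong (ℤ._+_ (ℤ.- f zero)) (∑-neg (f ∘ suc)))
                        (sym (ℤ.neg-distrib-+ (f zero) (∑ (f ∘ suc))))

lookup-suc : ∀ (e : Fin n) c i → lookup (c Vec.[ e ]%= ℤ.suc) i ≡ lookup (unit e) i ℤ.+ lookup c i
lookup-suc zero    (z ∷ c) zero    = refl
lookup-suc zero    (z ∷ c) (suc i) = sym (trans (cong (ℤ._+ lookup c i) (lookup-replicate i (+ 0))) (ℤ.+-identityˡ (lookup c i)))
lookup-suc (suc e) (z ∷ c) zero    = sym (ℤ.+-identityˡ z)
lookup-suc (suc e) (z ∷ c) (suc i) = lookup-suc e c i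

lookup-pred : ∀ (e : Fin n) c i → lookup (c Vec.[ e ]%= ℤ.pred) i ≡ ℤ.- lookup (unit e) i ℤ.+ lookup c i
lookup-pred zero    (z ∷ c) zero    = refl
lookup-pred zero    (z ∷ c) (suc i) =
  sym (trans (cong (λ x → ℤ.- x ℤ.+ lookup c i) (lookup-replicate i (+ 0))) (ℤ.+-identityˡ (lookup c i)))
lookup-pred (suc e) (z ∷ c) zero    = sym (ℤ.+-identityˡ z)
lookup-pred (suc e) (z ∷ c) (suc i) = lookup-pred e c i

-- Assignments as inequalities.

-- These are the two edge labels of the query x_e ≥ 1, since the left one is x_e ≤ `pred 1`.
label : Fin n × Bool → LinIneq n
label (e , false) = unit e ·x≤ + 0
label (e , true)  = unit e ·x≥ + 1

labels : Assignment n → Weighted n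
labels = map λ l → 1 , label l

-- Each literal of the clause is cancelled by the label that falsifies it: a summand x_e by -x_e ≥
-- 0, and a summand -x_e by x_e ≥ 1.
falsified-coeff : ∀ (α : Assignment n) i →
                  coeff i (clauseIneq (ruleOut α)) ℤ.+ total (coeff i) (labels α) ≡ + 0
falsified-coeff []              i = trans (ℤ.+-identityʳ _) (lookup-replicate i (+ 0))
falsified-coeff ((e , false) ∷ α) i = begin
  lookup (coeffs (clauseIneq (ruleOut α)) Vec.[ e ]%= ℤ.suc) i
    ℤ.+ (+ 1 ℤ.* lookup (Vec.map ℤ.-_ (unit e)) i ℤ.+ total (coeff i) (labels α))
    ≡⟨ cong₂ (λ x y → x ℤ.+ (+ 1 ℤ.* y ℤ.+ total (coeff i) (labels α)))
             (lookup-suc e (coeffs (clauseIneq (ruleOut α))) i) (lookup-map i ℤ.-_ (unit e)) ⟩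
  (lookup (unit e) i ℤ.+ coeff i (clauseIneq (ruleOut α)))
    ℤ.+ (+ 1 ℤ.* (ℤ.- lookup (unit e) i) ℤ.+ total (coeff i) (labels α))
    ≡⟨ cancel (lookup (unit e) i) (coeff i (clauseIneq (ruleOut α))) (total (coeff i) (labels α)) ⟩
  coeff i (clauseIneq (ruleOut α)) ℤ.+ total (coeff i) (labels α)
    ≡⟨ falsified-coeff α i ⟩
  + 0 ∎
  where
  open ≡-Reasoning
  cancel : ∀ u x y → (u ℤ.+ x) ℤ.+ (+ 1 ℤ.* (ℤ.- u) ℤ.+ y) ≡ x ℤ.+ y
  cancel = ℤSolver.solve-∀
falsified-coeff ((e , true) ∷ α) i = begin
  lookup (coeffs (clauseIneq (ruleOut α)) Vec.[ e ]%= ℤ.pred) i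
    ℤ.+ (+ 1 ℤ.* lookup (unit e) i ℤ.+ total (coeff i) (labels α))
    ≡⟨ cong (ℤ._+ (+ 1 ℤ.* lookup (unit e) i ℤ.+ total (coeff i) (labels α)))
            (lookup-pred e (coeffs (clauseIneq (ruleOut α))) i) ⟩
  (ℤ.- lookup (unit e) i ℤ.+ coeff i (clauseIneq (ruleOut α)))
    ℤ.+ (+ 1 ℤ.* lookup (unit e) i ℤ.+ total (coeff i) (labels α))
    ≡⟨ cancel (lookup (unit e) i) (coeff i (clauseIneq (ruleOut α))) (total (coeff i) (labels α)) ⟩
  coeff i (clauseIneq (ruleOut α)) ℤ.+ total (coeff i) (labels α)
    ≡⟨ falsified-coeff α i ⟩
  + 0 ∎
  where
  open ≡-Reasoning
  cancel : ∀ u x y → (ℤ.- u ℤ.+ x) ℤ.+ (+ 1 ℤ.* u ℤ.+ y) ≡ x ℤ.+ y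
  cancel = ℤSolver.solve-∀

-- A negated literal lowers the bound by 1 and its label x_e ≥ 1 restores it; a positive literal and
-- its label change nothing. What remains is the 1 of the empty clause.
falsified-bound : ∀ (α : Assignment n) →
                  bound (clauseIneq (ruleOut α)) ℤ.+ total bound (labels α) ≡ + 1
falsified-bound []                = refl
falsified-bound ((e , false) ∷ α) =
  trans (cong (ℤ._+_ (bound (clauseIneq (ruleOut α)))) (ℤ.+-identityˡ (total bound (labels α)))) (falsified-bound α)
falsified-bound ((e , true) ∷ α)  =
  trans (cancel (bound (clauseIneq (ruleOut α))) (total bound (labels α))) (falsified-bound α)
  where
  cancel : ∀ x y → (-[1+ 0 ] ℤ.+ x) ℤ.+ (+ 1 ℤ.+ y) ≡ x ℤ.+ y
  cancel = ℤSolver.solve-∀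

trues : Assignment n → ℕ
trues α = sum (map (toBit ∘ proj₂) α)

odd-trues : ∀ (α : Assignment n) → odd (trues α) ≡ parity α
odd-trues []            = refl
odd-trues ((e , b) ∷ α) = trans (odd-+ (toBit b) (trues α)) (cong₂ _xor_ (odd-toBit b) (odd-trues α))

∑-units : List (Fin n) → Fin n → ℤ
∑-units []       i = + 0
∑-units (e ∷ es) i = lookup (unit e) i ℤ.+ ∑-units es i

-- With `uppers`, this fixes every assigned variable from both sides. For each variable one side is
-- its label and the other a box inequality, so both lists are available after branching.
lowers : Assignment n → Weighted n
lowers = map λ (e , b) → 1 , (unit e ·x≥ + toBit b)

uppers : Assignment n → Weighted n
uppers = map λ (e , b) → 1 , (unit e ·x≤ + toBit b)

lowers-coeff : ∀ (α : Assignment n) i → total (coeff i) (lowers α) ≡ ∑-units (map proj₁ α) i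
lowers-coeff []            i = refl
lowers-coeff ((e , b) ∷ α) i = cong₂ ℤ._+_ (ℤ.*-identityˡ (lookup (unit e) i)) (lowers-coeff α i)

lowers-bound : ∀ (α : Assignment n) → total bound (lowers α) ≡ + trues α
lowers-bound []            = refl
lowers-bound ((e , b) ∷ α) = cong₂ ℤ._+_ (ℤ.*-identityˡ (+ toBit b)) (lowers-bound α)

uppers-coeff : ∀ (α : Assignment n) i → total (coeff i) (uppers α) ≡ ℤ.- ∑-units (map proj₁ α) i
uppers-coeff []            i = refl
uppers-coeff ((e , b) ∷ α) i = trans
  (cong₂ ℤ._+_ (trans (ℤ.*-identityˡ _) (lookup-map i ℤ.-_ (unit e))) (uppers-coeff α i))
  (sym (ℤ.neg-distrib-+ (lookup (unit e) i) (∑-units (map proj₁ α) i)))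

uppers-bound : ∀ (α : Assignment n) → total bound (uppers α) ≡ ℤ.- (+ trues α)
uppers-bound []            = refl
uppers-bound ((e , b) ∷ α) = trans
  (cong₂ ℤ._+_ (ℤ.*-identityˡ (ℤ.- (+ toBit b))) (uppers-bound α))
  (sym (ℤ.neg-distrib-+ (+ toBit b) (+ trues α)))

assignments-vars : ∀ (es : List (Fin n)) {α} → α ∈ assignments es → map proj₁ α ≡ es
assignments-vars []       (here refl) = refl
assignments-vars (e ∷ es) α∈ with ∈-++⁻ (map ((e , false) ∷_) (assignments es)) α∈
... | inj₁ α∈₀ with ∈-map⁻ _ α∈₀
...   | β , β∈ , refl = cong (e ∷_) (assignments-vars es β∈)
assignments-vars (e ∷ es) α∈ | inj₂ α∈₁ with ∈-map⁻ _ α∈₁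
...   | β , β∈ , refl = cong (e ∷_) (assignments-vars es β∈)

-- Filtering is traded for weights 0 and 1 on the full list, where `total-tabulate` and `∑-unit`
-- apply.
∑-units-filter : ∀ {p} {P : Fin n → Set p} (P? : ∀ e → Dec (P e)) xs i →
                 ∑-units (filter P? xs) i ≡
                 total (coeff i) (map (λ e → toBit (does (P? e)) , (unit e ·x≥ + 0)) xs)
∑-units-filter P? []       i = refl
∑-units-filter P? (e ∷ es) i with does (P? e)
... | true  = cong₂ ℤ._+_ (sym (ℤ.*-identityˡ (lookup (unit e) i))) (∑-units-filter P? es i)
... | false = trans (∑-units-filter P? es i) (sym (ℤ.+-identityˡ _))

∑-units-filter-allFin : ∀ {p} {P : Fin n → Set p} (P? : ∀ e → Dec (P e)) i →
                        ∑-units (filter P? (allFin n)) i ≡ + toBit (does (P? i))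
∑-units-filter-allFin {n = n} P? i = begin
  ∑-units (filter P? (allFin n)) i            ≡⟨ ∑-units-filter P? (allFin n) i ⟩
  total (coeff i) (map g (allFin n))          ≡⟨ cong (total (coeff i)) (map-tabulate id g) ⟩
  total (coeff i) (tabulate g)                ≡⟨ total-tabulate (coeff i) g ⟩
  ∑ (λ e → + toBit (does (P? e)) ℤ.* lookup (unit e) i) ≡⟨ ∑-unit (λ e → + toBit (does (P? e))) i ⟩
  + toBit (does (P? i))                       ∎
  where
  open ≡-Reasoning
  g : Fin n → ℕ × LinIneq n
  g e = toBit (does (P? e)) , (unit e ·x≥ + 0)

-- Coefficient bounds and box inequalities.

toBit≤1 : ∀ b → toBit b ≤ 1
toBit≤1 false = z≤n
toBit≤1 true  = ≤-refl

Bits : Vec ℤ n → Set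
Bits v = ∀ i → ∣ lookup v i ∣ ≤ 1

form-bits : ∀ (p : Fin n → Bool) → Bits (form p)
form-bits p i = subst (λ z → ∣ z ∣ ≤ 1) (sym (lookup∘tabulate _ i)) (toBit≤1 (p i))

unit-bits : ∀ (e : Fin n) → Bits (unit e)
unit-bits zero    zero    = ≤-refl
unit-bits zero    (suc i) = ≤-trans (≤-reflexive (cong ∣_∣ (lookup-replicate i (+ 0)))) z≤n
unit-bits (suc e) zero    = z≤n
unit-bits (suc e) (suc i) = unit-bits e i

∣pred∣≤ : ∀ d → ∣ ℤ.pred d ∣ ≤ suc ∣ d ∣
∣pred∣≤ d = ℤ.∣i+j∣≤∣i∣+∣j∣ (ℤ.- + 1) d

lower∈box : ∀ (e : Fin n) → (unit e ·x≥ + 0) ∈ boxIneqs n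
lower∈box e = ∈-concatMap⁺ _ (lose (∈-allFin e) (here refl))

upper∈box : ∀ (e : Fin n) → (unit e ·x≤ + 1) ∈ boxIneqs n
upper∈box e = ∈-concatMap⁺ _ (lose (∈-allFin e) (there (here refl)))

-- Building refutations from queries and conflicts.

-- `K` bounds every number in an inequality. By `cost`, `c` pays for a leaf with `2 + K` entries and
-- multipliers up to K³, and hence also for a query.
module Calculus {n : ℕ} (base : List (LinIneq n)) (box⊆base : boxIneqs n ⊆ base)
                (K c : ℕ) (4≤K : 4 ≤ K)
                (cost : suc ((2 + K) * (K * (K * K) + 3 + suc n * (2 + K))) ≤ c) where

  record System : Set where
    field
      ineqs : List (LinIneq n)
      base⊆ : base ⊆ ineqs
      small : ∀ {I} → I ∈ ineqs → Small K I

    lower∈ : ∀ e → (unit e ·x≥ + 0) ∈ ineqs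
    lower∈ e = base⊆ (box⊆base (lower∈box e))

    upper∈ : ∀ e → (unit e ·x≤ + 1) ∈ ineqs
    upper∈ e = base⊆ (box⊆base (upper∈box e))

  open System public

  infix 4 _⊢_ _≼_

  _⊢_ : System → ℕ → Set
  S ⊢ D = Refutes c D (ineqs S)

  _≼_ : System → System → Set
  S ≼ T = ineqs S ⊆ ineqs T

  private
    variable
      S T : System
      D : ℕ

  1≤K : 1 ≤ K
  1≤K = ≤-trans (s≤s z≤n) 4≤K

  extend : (S : System) (I : LinIneq n) → Small K I → System
  extend S I I-small = record
    { ineqs = I ∷ ineqs S
    ; base⊆ = there ∘ base⊆ S
    ; small = λ { (here refl) → I-small ; (there I∈S) → small S I∈S }
    }

  small-≥ : ∀ (v : Vec ℤ n) d → Bits v → ∣ d ∣ ≤ K → Small K (v ·x≥ d)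
  small-≥ v d v-bits d≤K = (λ i → ≤-trans (v-bits i) 1≤K) , d≤K

  small-≤ : ∀ (v : Vec ℤ n) d → Bits v → ∣ d ∣ ≤ K → Small K (v ·x≤ d)
  small-≤ v d v-bits d≤K =
    (λ i → ≤-trans (≤-reflexive (trans (cong ∣_∣ (lookup-map i ℤ.-_ v)) (ℤ.∣-i∣≡∣i∣ (lookup v i))))
                   (≤-trans (v-bits i) 1≤K)) ,
    ≤-trans (≤-reflexive (ℤ.∣-i∣≡∣i∣ d)) d≤K

  -- Trees are built in continuation-passing style: a branch is given for every system `T`
  -- containing `S` and the new label, so inequalities obtained higher up are carried along
  -- inclusions.
  ask : ∀ S (v : Vec ℤ n) → Bits v → ∀ d → ∣ d ∣ < K →
        (∀ T → S ≼ T → (v ·x≤ ℤ.pred d) ∈ ineqs T → T ⊢ D) →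
        (∀ T → S ≼ T → (v ·x≥ d) ∈ ineqs T → T ⊢ D) →
        S ⊢ suc D
  ask S v v-bits d d<K l r =
    refutes-query v d bits≤c
      (l (extend S _ ≤-small) there (here refl)) (r (extend S _ ≥-small) there (here refl))
    where
    ≤-small : Small K (v ·x≤ ℤ.pred d)
    ≤-small = small-≤ v (ℤ.pred d) v-bits (≤-trans (∣pred∣≤ d) d<K)
    ≥-small : Small K (v ·x≥ d)
    ≥-small = small-≥ v d v-bits (<⇒≤ d<K)
    bits≤c : suc (bitsIneq (v ·x≤ ℤ.pred d) + bitsIneq (v ·x≥ d)) ≤ c
    bits≤c = begin
      suc (bitsIneq (v ·x≤ ℤ.pred d) + bitsIneq (v ·x≥ d))
        ≤⟨ s≤s (+-mono-≤ (bitsIneq≤ (v ·x≤ ℤ.pred d) ≤-small) (bitsIneq≤ (v ·x≥ d) ≥-small)) ⟩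
      suc (w + w)
        ≡⟨ cong (λ x → suc (w + x)) (+-identityʳ w) ⟨
      suc (2 * w)
        ≤⟨ s≤s (*-mono-≤ (m≤m+n 2 K) (m≤n+m w (K * (K * K) + 3))) ⟩
      suc ((2 + K) * (K * (K * K) + 3 + w))
        ≤⟨ cost ⟩
      c ∎
      where
      open ≤-Reasoning
      w : ℕ
      w = suc n * (2 + K)

  -- The limits K³ on multipliers and `2 + K` on the length leave room for the pair of box
  -- inequalities that `conflict⁺` adds.
  conflict′ : ∀ S (L : Weighted n) →
              All (λ (k , I) → k ≤ K * (K * K) × I ∈ ineqs S) L → length L ≤ 2 + K →
              (∀ i → total (coeff i) L ≡ + 0) → total bound L ≡ + 1 → S ⊢ D
  conflict′ S L valid len≤ coeffs≡0 bound≡1 =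
    refutes-leaf (rational L)
      (All.map⁺ (All.map (λ {(k , I)} (_ , I∈S) → nonNegative k , I∈S) valid))
      ((λ i → trans (combine-rational (coeff i) L) (cong ℤ⇒ℚ (coeffs≡0 i))) ,
       trans (combine-rational bound L) (cong ℤ⇒ℚ bound≡1))
      (≤-trans (s≤s (≤-trans
        (bitsCombination≤ L (All.map (λ (k≤ , I∈S) → k≤ , small S I∈S) valid))
        (*-monoˡ-≤ (K * (K * K) + 3 + suc n * (2 + K)) len≤))) cost)
    where
    nonNegative : ∀ k → ℚ.NonNegative (ℤ⇒ℚ (+ k))
    nonNegative k = ℚ.normalize-nonNeg k 1

  K≤K³ : K ≤ K * (K * K)
  K≤K³ = m≤m*n K (K * K) {{>-nonZero (*-mono-≤ 1≤K 1≤K)}}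

  conflict : ∀ S (L : Weighted n) →
             All (λ (k , I) → k ≤ K × I ∈ ineqs S) L → length L ≤ K →
             (∀ i → total (coeff i) L ≡ + 0) → total bound L ≡ + 1 → S ⊢ D
  conflict S L valid len≤ =
    conflict′ S L (All.map (λ (k≤K , I∈S) → ≤-trans k≤K K≤K³ , I∈S) valid) (m≤n⇒m≤o+n 2 len≤)

  -- Adding m times both bounds of one variable turns 0 ≥ m + 1 into 0 ≥ 1.
  conflict⁺ : Fin n → ∀ S (L : Weighted n) →
              All (λ (k , I) → k ≤ K × I ∈ ineqs S) L → length L ≤ K →
              (∀ i → total (coeff i) L ≡ + 0) → ∀ m → total bound L ≡ + suc m → S ⊢ D
  conflict⁺ e S L valid len≤ coeffs≡0 m bound≡ =
    conflict′ S ((m , (unit e ·x≥ + 0)) ∷ (m , (unit e ·x≤ + 1)) ∷ L)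
      ((m≤ , lower∈ S e) ∷ (m≤ , upper∈ S e) ∷
       All.map (λ (k≤K , I∈S) → ≤-trans k≤K K≤K³ , I∈S) valid)
      (s≤s (s≤s len≤)) coeffs≡0′
      (trans (cong (λ z → + m ℤ.* + 0 ℤ.+ (+ m ℤ.* -[1+ 0 ] ℤ.+ z)) bound≡) (cancel (+ m)))
    where
    m≤ : m ≤ K * (K * K)
    m≤ = begin
      m                    ≤⟨ n≤1+n m ⟩
      suc m                ≡⟨ cong ∣_∣ bound≡ ⟨
      ∣ total bound L ∣    ≤⟨ ∣total∣≤ L (All.map (λ (k≤K , I∈S) → k≤K , small S I∈S) valid) ⟩
      length L * (K * K)   ≤⟨ *-monoˡ-≤ (K * K) len≤ ⟩
      K * (K * K)          ∎
      where open ≤-Reasoning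
    cancel : ∀ x → x ℤ.* + 0 ℤ.+ (x ℤ.* -[1+ 0 ] ℤ.+ (+ 1 ℤ.+ x)) ≡ + 1
    cancel = ℤSolver.solve-∀
    cancel-coeff : ∀ x u → x ℤ.* u ℤ.+ (x ℤ.* (ℤ.- u) ℤ.+ + 0) ≡ + 0
    cancel-coeff = ℤSolver.solve-∀
    coeffs≡0′ : ∀ i → total (coeff i) ((m , (unit e ·x≥ + 0)) ∷ (m , (unit e ·x≤ + 1)) ∷ L) ≡ + 0
    coeffs≡0′ i = trans
      (cong₂ (λ y z → + m ℤ.* lookup (unit e) i ℤ.+ (+ m ℤ.* y ℤ.+ z)) (lookup-map i ℤ.-_ (unit e)) (coeffs≡0 i))
      (cancel-coeff (+ m) (lookup (unit e) i))

  record Value (S : System) (p : Fin n → Bool) (k : ℤ) : Set where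
    constructor _,_
    field
      value-≥ : (form p ·x≥ k) ∈ ineqs S
      value-≤ : (form p ·x≤ k) ∈ ineqs S

  open Value public

  weaken : ∀ {p k} → S ≼ T → Value S p k → Value T p k
  weaken S≼T (lo , hi) = S≼T lo , S≼T hi

  -- The derivation of `form p` ≥ 0 from the box. Edges outside `p` get weight 0, which keeps the
  -- list a tabulation over all edges.
  boxLowers : (Fin n → Bool) → Weighted n
  boxLowers p = tabulate λ e → toBit (p e) , (unit e ·x≥ + 0)

  boxLowers-coeff : ∀ p i → total (coeff i) (boxLowers p) ≡ + toBit (p i)
  boxLowers-coeff p i = trans (total-tabulate (coeff i) (λ e → toBit (p e) , (unit e ·x≥ + 0))) (∑-unit (λ e → + toBit (p e)) i)

  boxLowers-bound : ∀ p → total bound (boxLowers p) ≡ + 0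
  boxLowers-bound p = trans (total-tabulate bound (λ e → toBit (p e) , (unit e ·x≥ + 0)))
    (trans (∑-cong (λ e → ℤ.*-zeroʳ (+ toBit (p e)))) (∑-zero n))

  boxUppers : (Fin n → Bool) → Weighted n
  boxUppers p = tabulate λ e → toBit (p e) , (unit e ·x≤ + 1)

  boxUppers-coeff : ∀ p i → total (coeff i) (boxUppers p) ≡ ℤ.- (+ toBit (p i))
  boxUppers-coeff p i = begin
    total (coeff i) (boxUppers p)
      ≡⟨ total-tabulate (coeff i) (λ e → toBit (p e) , (unit e ·x≤ + 1)) ⟩
    ∑ (λ e → + toBit (p e) ℤ.* lookup (Vec.map ℤ.-_ (unit e)) i)
      ≡⟨ ∑-cong (λ e → trans (cong (+ toBit (p e) ℤ.*_) (lookup-map i ℤ.-_ (unit e)))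
                             (sym (ℤ.neg-distribʳ-* (+ toBit (p e)) (lookup (unit e) i)))) ⟩
    ∑ (λ e → ℤ.- (+ toBit (p e) ℤ.* lookup (unit e) i))
      ≡⟨ ∑-neg (λ e → + toBit (p e) ℤ.* lookup (unit e) i) ⟩
    ℤ.- ∑ (λ e → + toBit (p e) ℤ.* lookup (unit e) i)
      ≡⟨ cong ℤ.-_ (∑-unit (λ e → + toBit (p e)) i) ⟩
    ℤ.- (+ toBit (p i)) ∎
    where open ≡-Reasoning

  boxUppers-bound : ∀ p → total bound (boxUppers p) ≡ ℤ.- ∑ (λ e → + toBit (p e))
  boxUppers-bound p = trans (total-tabulate bound (λ e → toBit (p e) , (unit e ·x≤ + 1)))
    (trans (∑-cong (λ e → trans (sym (ℤ.neg-distribʳ-* (+ toBit (p e)) (+ 1))) (cong ℤ.-_ (ℤ.*-identityʳ (+ toBit (p e))))))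
           (∑-neg (λ e → + toBit (p e))))

  branch : ∀ es S →
           (∀ α T → α ∈ assignments es → S ≼ T → All (λ l → label l ∈ ineqs T) α → T ⊢ D) →
           S ⊢ length es + D
  branch []       S found = found [] S (here refl) id []
  branch (e ∷ es) S found =
    ask S (unit e) (unit-bits e) (+ 1) (≤-trans (s≤s (s≤s z≤n)) 4≤K)
      (λ T S≼T e≤0 → branch es T λ α U α∈ T≼U α-labels →
        found ((e , false) ∷ α) U (∈-++⁺ˡ (∈-map⁺ _ α∈)) (T≼U ∘ S≼T) (T≼U e≤0 ∷ α-labels))
      (λ T S≼T e≥1 → branch es T λ α U α∈ T≼U α-labels →
        found ((e , true) ∷ α) U (∈-++⁺ʳ _ (∈-map⁺ _ α∈)) (T≼U ∘ S≼T) (T≼U e≥1 ∷ α-labels))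

  conflict-clause : ∀ S (α : Assignment n) → length α < K → clauseIneq (ruleOut α) ∈ ineqs S →
                    All (λ l → label l ∈ ineqs S) α → S ⊢ D
  conflict-clause S α α<K clause∈ α-labels =
    conflict S ((1 , clauseIneq (ruleOut α)) ∷ labels α)
      ((1≤K , clause∈) ∷ All.map⁺ (All.map (1≤K ,_) α-labels))
      (≤-trans (s≤s (≤-reflexive (length-map _ α))) α<K)
      (λ i → trans (cong (ℤ._+ total (coeff i) (labels α)) (ℤ.*-identityˡ (coeff i (clauseIneq (ruleOut α)))))
                   (falsified-coeff α i))
      (trans (cong (ℤ._+ total bound (labels α)) (ℤ.*-identityˡ (bound (clauseIneq (ruleOut α))))) (falsified-bound α))

  -- Determining the value of a form.

  -- A form sums at most `n` variables, so `2 ^ J` exceeds all its values on the box. The box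
  -- inequalities of the edge `e₀` serve for scaling in `conflict⁺`.
  module Search (e₀ : Fin n) (J : ℕ) (n<2^J : n < 2 ^ J) (2^J<K : 2 ^ J < K) where

    n<K : n < K
    n<K = <-trans n<2^J 2^J<K

    toBit≤K : ∀ b → toBit b ≤ K
    toBit≤K b = ≤-trans (toBit≤1 b) 1≤K

    conflict-below : ∀ S p → (form p ·x≤ ℤ.pred (+ 0)) ∈ ineqs S → S ⊢ D
    conflict-below S p below = conflict S ((1 , (form p ·x≤ ℤ.pred (+ 0))) ∷ boxLowers p)
      ((1≤K , below) ∷ All.tabulate⁺ (λ e → toBit≤K (p e) , lower∈ S e))
      (≤-trans (s≤s (≤-reflexive (length-tabulate _))) n<K)
      (λ i → trans (cong₂ (λ y z → + 1 ℤ.* y ℤ.+ z) (coeff-≤ p (ℤ.pred (+ 0)) i) (boxLowers-coeff p i))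
                   (cancel (+ toBit (p i))))
      (cong (ℤ._+_ (+ 1)) (boxLowers-bound p))
      where
      cancel : ∀ x → + 1 ℤ.* (ℤ.- x) ℤ.+ x ≡ + 0
      cancel = ℤSolver.solve-∀

    conflict-above : ∀ S p → (form p ·x≥ + (2 ^ J)) ∈ ineqs S → S ⊢ D
    conflict-above S p above with ∑-toBit p
    ... | s , ∑≡s , s≤n = conflict⁺ e₀ S ((1 , (form p ·x≥ + (2 ^ J))) ∷ boxUppers p)
      ((1≤K , above) ∷ All.tabulate⁺ (λ e → toBit≤K (p e) , upper∈ S e))
      (≤-trans (s≤s (≤-reflexive (length-tabulate _))) n<K)
      (λ i → trans (cong₂ (λ y z → + 1 ℤ.* y ℤ.+ z) (coeff-≥ p (+ (2 ^ J)) i) (boxUppers-coeff p i))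
                   (cancel (+ toBit (p i))))
      -- The sum is 0 ≥ 2^J - s, which is positive because s ≤ n < 2^J; `conflict⁺` takes the
      -- predecessor.
      (2 ^ J ∸ suc s)
      (begin
        + 1 ℤ.* + (2 ^ J) ℤ.+ total bound (boxUppers p)
          ≡⟨ cong₂ ℤ._+_ (ℤ.*-identityˡ (+ (2 ^ J))) (trans (boxUppers-bound p) (cong ℤ.-_ ∑≡s)) ⟩
        + (2 ^ J) ℤ.+ ℤ.- (+ s)
          ≡⟨ ℤ.m-n≡m⊖n (2 ^ J) s ⟩
        2 ^ J ℤ.⊖ s
          ≡⟨ ℤ.⊖-≥ (<⇒≤ s<2^J) ⟩
        + (2 ^ J ∸ s)
          ≡⟨ cong +_ (+-∸-assoc 1 s<2^J) ⟩
        + suc (2 ^ J ∸ suc s) ∎)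
      where
      open ≡-Reasoning
      s<2^J : s < 2 ^ J
      s<2^J = ≤-<-trans s≤n n<2^J
      cancel : ∀ x → + 1 ℤ.* x ℤ.+ (ℤ.- x) ≡ + 0
      cancel = ℤSolver.solve-∀

    -- The invariant is lo ≤ `form p` < lo + 2^j. At j = 0 the upper bound `pred (1 + lo)` reduces
    -- to `lo`, so the two inequalities already form a `Value`.
    bisect : ∀ j lo S p → 2 ^ j + lo ≤ 2 ^ J →
             (form p ·x≥ + lo) ∈ ineqs S → (form p ·x≤ ℤ.pred (+ (2 ^ j + lo))) ∈ ineqs S →
             (∀ a T → a ≤ 2 ^ J → S ≼ T → Value T p (+ a) → T ⊢ D) →
             S ⊢ j + D
    bisect zero lo S p ≤2^J lo∈S hi∈S found = found lo S (≤-trans (n≤1+n lo) ≤2^J) id (lo∈S , hi∈S)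
    bisect (suc j) lo S p ≤2^J lo∈S hi∈S found =
      ask S (form p) (form-bits p) (+ mid) (≤-<-trans mid≤2^J 2^J<K)
        (λ T S≼T mid∈T → bisect j lo T p mid≤2^J (S≼T lo∈S) mid∈T
          (λ a U a≤ T≼U → found a U a≤ (T≼U ∘ S≼T)))
        (λ T S≼T mid∈T → bisect j mid T p (subst (_≤ 2 ^ J) hi≡ ≤2^J) mid∈T
          (subst (λ h → (form p ·x≤ ℤ.pred (+ h)) ∈ ineqs T) hi≡ (S≼T hi∈S))
          (λ a U a≤ T≼U → found a U a≤ (T≼U ∘ S≼T)))
      where
      mid : ℕ
      mid = 2 ^ j + lo
      hi≡ : 2 ^ suc j + lo ≡ 2 ^ j + mid
      hi≡ = trans (cong (λ x → 2 ^ j + x + lo) (+-identityʳ (2 ^ j))) (+-assoc (2 ^ j) (2 ^ j) lo)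
      mid≤2^J : mid ≤ 2 ^ J
      mid≤2^J = ≤-trans (m≤n+m mid (2 ^ j)) (subst (_≤ 2 ^ J) hi≡ ≤2^J)

    -- Queries at 0 and at 2^J confine the form to the half-open range [0, 2^J); the two outer
    -- branches contradict the box, and `bisect` spends `J` more queries.
    search : ∀ S p → (∀ a T → a ≤ 2 ^ J → S ≼ T → Value T p (+ a) → T ⊢ D) → S ⊢ 2 + J + D
    search S p found =
      ask S (form p) (form-bits p) (+ 0) 1≤K
        (λ T _ below → conflict-below T p below)
        (λ T S≼T lo∈T → ask T (form p) (form-bits p) (+ (2 ^ J)) 2^J<K
          (λ U T≼U hi∈U → bisect J 0 U p (≤-reflexive (+-identityʳ (2 ^ J))) (T≼U lo∈T)
            (subst (λ h → (form p ·x≤ ℤ.pred (+ h)) ∈ ineqs U) (sym (+-identityʳ (2 ^ J))) hi∈U)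
            (λ a V a≤ U≼V → found a V a≤ (U≼V ∘ T≼U ∘ S≼T)))
          (λ U _ above → conflict-above U p above))

    -- An empty form needs no search: one query on either side of 0 suffices, as the outer branches
    -- are contradictory.
    pin-zero : ∀ S p → (∀ i → p i ≡ false) → (∀ T → S ≼ T → Value T p (+ 0) → T ⊢ D) → S ⊢ 2 + D
    pin-zero S p p≡0 found =
      ask S (form p) (form-bits p) (+ 0) 1≤K
        (λ T _ below → conflict-below T p below)
        (λ T S≼T lo∈T → ask T (form p) (form-bits p) (+ 1) (≤-trans (s≤s (s≤s z≤n)) 4≤K)
          (λ U T≼U hi∈U → found U (T≼U ∘ S≼T) (T≼U lo∈T , hi∈U))
          (λ U _ above → conflict U ((1 , (form p ·x≥ + 1)) ∷ []) ((1≤K , above) ∷ []) 1≤K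
            (λ i → cong (λ y → + 1 ℤ.* y ℤ.+ + 0) (trans (coeff-≥ p (+ 1) i) (cong (λ b → + toBit b) (p≡0 i))))
            refl))

    record Sum (S : System) (p q r : Fin n → Bool) (k : ℤ) (a c : ℕ) : Set where
      field
        p-value : Value S p (+ a)
        both    : Value S (λ i → p i ∧ q i) (+ c)
        r-value : Value S r k

    -- For p, q ∈ {0,1}: q = (p xor q) + 2 (p ∧ q) − p.
    pin-sum : ∀ S p q r → (∀ i → r i ≡ p i xor q i) → ∀ k a c → Sum S p q r k a c →
              let b = k ℤ.+ (+ c ℤ.+ + c) ℤ.- + a in
              2 + ∣ b ∣ ≤ K → (∀ T → S ≼ T → Value T q b → T ⊢ D) → S ⊢ 2 + D
    pin-sum S p q r r≡ k a c sum b<K found =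
      ask S (form q) (form-bits q) b (<⇒≤ b<K)
        -- The lower bounds of `r` and, doubled, of the conjunction together with the upper bound of
        -- `p` give `form q` ≥ b, which contradicts the label `form q` ≤ b - 1.
        (λ T S≼T below → conflict T
          ((1 , (form q ·x≤ ℤ.pred b)) ∷ (1 , (form r ·x≥ k)) ∷ (2 , (form pq ·x≥ + c)) ∷ (1 , (form p ·x≤ + a)) ∷ [])
          ((1≤K , below) ∷ (1≤K , S≼T (value-≥ r-value)) ∷ (2≤K , S≼T (value-≥ both)) ∷ (1≤K , S≼T (value-≤ p-value)) ∷ [])
          4≤K
          (λ i → trans (cong₂ ℤ._+_ (cong (+ 1 ℤ.*_) (coeff-≤ q (ℤ.pred b) i))
                  (cong₂ ℤ._+_ (cong (+ 1 ℤ.*_) (trans (coeff-≥ r k i) (cong (λ x → + toBit x) (r≡ i))))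
                  (cong₂ ℤ._+_ (cong (+ 2 ℤ.*_) (coeff-≥ pq (+ c) i))
                               (cong (λ x → + 1 ℤ.* x ℤ.+ + 0) (coeff-≤ p (+ a) i)))))
                  (bits-below (p i) (q i)))
          (bound-below k (+ a) (+ c)))
        -- The query is at b + 1 so that its left label is the missing half `form q` ≤ b.
        (λ T S≼T lo∈T → ask T (form q) (form-bits q) (ℤ.suc b) (≤-trans (s≤s (ℤ.∣i+j∣≤∣i∣+∣j∣ (+ 1) b)) b<K)
          (λ U T≼U hi∈U → found U (T≼U ∘ S≼T)
            (T≼U lo∈T , subst (λ d → (form q ·x≤ d) ∈ ineqs U) (ℤ.pred-suc b) hi∈U))
          (λ U T≼U above → conflict U
            ((1 , (form q ·x≥ ℤ.suc b)) ∷ (1 , (form r ·x≤ k)) ∷ (2 , (form pq ·x≤ + c)) ∷ (1 , (form p ·x≥ + a)) ∷ [])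
            ((1≤K , above) ∷ (1≤K , T≼U (S≼T (value-≤ r-value))) ∷
             (2≤K , T≼U (S≼T (value-≤ both))) ∷ (1≤K , T≼U (S≼T (value-≥ p-value))) ∷ [])
            4≤K
            (λ i → trans (cong₂ ℤ._+_ (cong (+ 1 ℤ.*_) (coeff-≥ q (ℤ.suc b) i))
                    (cong₂ ℤ._+_ (cong (+ 1 ℤ.*_) (trans (coeff-≤ r k i) (cong (λ x → ℤ.- (+ toBit x)) (r≡ i))))
                    (cong₂ ℤ._+_ (cong (+ 2 ℤ.*_) (coeff-≤ pq (+ c) i))
                                 (cong (λ x → + 1 ℤ.* x ℤ.+ + 0) (coeff-≥ p (+ a) i)))))
                    (bits-above (p i) (q i)))
            (bound-above k (+ a) (+ c))))
      where
      open Sum sum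
      b : ℤ
      b = k ℤ.+ (+ c ℤ.+ + c) ℤ.- + a
      pq : Fin n → Bool
      pq i = p i ∧ q i
      2≤K : 2 ≤ K
      2≤K = ≤-trans (s≤s (s≤s z≤n)) 4≤K
      bits-below : ∀ x y →
        + 1 ℤ.* (ℤ.- (+ toBit y)) ℤ.+ (+ 1 ℤ.* (+ toBit (x xor y)) ℤ.+
          (+ 2 ℤ.* (+ toBit (x ∧ y)) ℤ.+ (+ 1 ℤ.* (ℤ.- (+ toBit x)) ℤ.+ + 0))) ≡ + 0
      bits-below false false = refl
      bits-below false true  = refl
      bits-below true  false = refl
      bits-below true  true  = refl
      bits-above : ∀ x y →
        + 1 ℤ.* (+ toBit y) ℤ.+ (+ 1 ℤ.* (ℤ.- (+ toBit (x xor y))) ℤ.+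
          (+ 2 ℤ.* (ℤ.- (+ toBit (x ∧ y))) ℤ.+ (+ 1 ℤ.* (+ toBit x) ℤ.+ + 0))) ≡ + 0
      bits-above false false = refl
      bits-above false true  = refl
      bits-above true  false = refl
      bits-above true  true  = refl
      bound-below : ∀ k a c →
        + 1 ℤ.* (ℤ.- (-[1+ 0 ] ℤ.+ (k ℤ.+ (c ℤ.+ c) ℤ.- a))) ℤ.+
          (+ 1 ℤ.* k ℤ.+ (+ 2 ℤ.* c ℤ.+ (+ 1 ℤ.* (ℤ.- a) ℤ.+ + 0))) ≡ + 1
      bound-below = ℤSolver.solve-∀
      bound-above : ∀ k a c →
        + 1 ℤ.* (+ 1 ℤ.+ (k ℤ.+ (c ℤ.+ c) ℤ.- a)) ℤ.+
          (+ 1 ℤ.* (ℤ.- k) ℤ.+ (+ 2 ℤ.* (ℤ.- c) ℤ.+ (+ 1 ℤ.* a ℤ.+ + 0))) ≡ + 1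
      bound-above = ℤSolver.solve-∀

    -- Two searches of depth 2 + J and one `pin-sum` of depth 2 give 6 + 2J. The value b = k + 2c -
    -- a is computed and not searched for, so it may leave [0, 2^J]; as a and c are at most 2^J, its
    -- absolute value grows by at most 3 · 2^J. The term 2c does not affect parity.
    split : ∀ S p q r → (∀ i → r i ≡ p i xor q i) → ∀ k → Value S r k → 2 + (∣ k ∣ + 3 * 2 ^ J) ≤ K →
            (∀ a b T → oddℤ k ≡ oddℤ a xor oddℤ b →
              ∣ a ∣ ≤ ∣ k ∣ + 3 * 2 ^ J → ∣ b ∣ ≤ ∣ k ∣ + 3 * 2 ^ J →
              Value T p a → Value T q b → T ⊢ D) →
            S ⊢ (6 + 2 * J) + D
    split {D = D} S p q r r≡ k r-value k≤K found =
      subst (S ⊢_) (depth≡ J D)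
        (search S p λ a T a≤ S≼T p-value →
         search T (λ i → p i ∧ q i) λ c U c≤ T≼U both →
         let b = k ℤ.+ (+ c ℤ.+ + c) ℤ.- + a
             b≤ = ∣b∣≤ a c a≤ c≤ in
         pin-sum U p q r r≡ k a c
           (record { p-value = weaken {S = T} {T = U} T≼U p-value ; both = both
                   ; r-value = weaken {S = S} {T = U} (T≼U ∘ S≼T) r-value })
           (≤-trans (s≤s (s≤s b≤)) k≤K)
           λ V U≼V q-value →
           found (+ a) b V (odd-sum a c)
             (≤-trans a≤ (≤-trans (m≤m+n (2 ^ J) _) (m≤n+m (3 * 2 ^ J) ∣ k ∣))) b≤
             (weaken {S = T} {T = V} (U≼V ∘ T≼U) p-value) q-value)
      where
      depth≡ : ∀ J D → 2 + J + (2 + J + (2 + D)) ≡ (6 + 2 * J) + D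
      depth≡ = ℕSolver.solve-∀
      ∣b∣≤ : ∀ a c → a ≤ 2 ^ J → c ≤ 2 ^ J → ∣ k ℤ.+ (+ c ℤ.+ + c) ℤ.- + a ∣ ≤ ∣ k ∣ + 3 * 2 ^ J
      ∣b∣≤ a c a≤ c≤ = begin
        ∣ k ℤ.+ (+ c ℤ.+ + c) ℤ.- + a ∣          ≤⟨ ℤ.∣i-j∣≤∣i∣+∣j∣ (k ℤ.+ (+ c ℤ.+ + c)) (+ a) ⟩
        ∣ k ℤ.+ (+ c ℤ.+ + c) ∣ + a              ≤⟨ +-mono-≤ (ℤ.∣i+j∣≤∣i∣+∣j∣ k (+ c ℤ.+ + c)) a≤ ⟩
        ∣ k ∣ + (c + c) + 2 ^ J                  ≤⟨ +-monoˡ-≤ (2 ^ J) (+-monoʳ-≤ ∣ k ∣ (+-mono-≤ c≤ c≤)) ⟩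
        ∣ k ∣ + (2 ^ J + 2 ^ J) + 2 ^ J          ≡⟨ triple ∣ k ∣ (2 ^ J) ⟩
        ∣ k ∣ + 3 * 2 ^ J                        ∎
        where
        open ≤-Reasoning
        triple : ∀ k x → k + (x + x) + x ≡ k + 3 * x
        triple = ℕSolver.solve-∀
      odd-sum : ∀ a c → oddℤ k ≡ odd a xor oddℤ (k ℤ.+ (+ c ℤ.+ + c) ℤ.- + a)
      odd-sum a c = begin
        oddℤ k                                     ≡⟨ xor-identityʳ (oddℤ k) ⟨
        oddℤ k xor false                           ≡⟨ cong (oddℤ k xor_) (odd-+-self c) ⟨
        oddℤ k xor odd (c + c)                     ≡⟨ oddℤ-+ k (+ c ℤ.+ + c) ⟨
        oddℤ kcc                                   ≡⟨ cong (_xor oddℤ kcc) (xor-same (odd a)) ⟨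
        (odd a xor odd a) xor oddℤ kcc             ≡⟨ xor-assoc (odd a) (odd a) (oddℤ kcc) ⟩
        odd a xor (odd a xor oddℤ kcc)             ≡⟨ cong (odd a xor_) (xor-comm (odd a) (oddℤ kcc)) ⟩
        odd a xor (oddℤ kcc xor odd a)             ≡⟨ cong (λ x → odd a xor (oddℤ kcc xor x)) (oddℤ-neg (+ a)) ⟨
        odd a xor (oddℤ kcc xor oddℤ (ℤ.- (+ a)))  ≡⟨ cong (odd a xor_) (oddℤ-+ kcc (ℤ.- (+ a))) ⟨
        odd a xor oddℤ (kcc ℤ.- + a)               ∎
        where
        open ≡-Reasoning
        kcc : ℤ
        kcc = k ℤ.+ (+ c ℤ.+ + c)

    -- The assignment forces the form to equal `trues α`, whose parity is `parity α`, so `k` differs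
    -- from it. The sign of the difference decides which inequality of the value is added to
    -- `uppers` or `lowers`.
    conflict-parity : ∀ S p k (α : Assignment n) → Value S p k →
                      (∀ i → ∑-units (map proj₁ α) i ≡ + toBit (p i)) → length α < K →
                      All (λ l → label l ∈ ineqs S) α → oddℤ k ≢ parity α → S ⊢ D
    conflict-parity S p k α (≥k , ≤k) α-sum α<K α-labels odd≢ with k ℤ.- + trues α in k-s
    ... | + zero   = contradiction (trans (cong oddℤ (ℤ.i-j≡0⇒i≡j k (+ trues α) k-s)) (odd-trues α)) odd≢
    ... | +[1+ m ] =
      conflict⁺ e₀ S ((1 , (form p ·x≥ k)) ∷ uppers α)
        ((1≤K , ≥k) ∷ All.map⁺ (All.map (λ {l} l∈ → 1≤K , upper l l∈) α-labels))
        (≤-trans (s≤s (≤-reflexive (length-map _ α))) α<K)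
        (λ i → trans (cong₂ (λ x y → + 1 ℤ.* x ℤ.+ y) (coeff-≥ p k i)
                            (trans (uppers-coeff α i) (cong ℤ.-_ (α-sum i))))
                     (cancel (+ toBit (p i))))
        m (trans (cong₂ ℤ._+_ (ℤ.*-identityˡ k) (uppers-bound α)) k-s)
      where
      upper : ∀ l → label l ∈ ineqs S → (unit (proj₁ l) ·x≤ + toBit (proj₂ l)) ∈ ineqs S
      upper (e , false) l∈ = l∈
      upper (e , true)  l∈ = upper∈ S e
      cancel : ∀ x → + 1 ℤ.* x ℤ.+ (ℤ.- x) ≡ + 0
      cancel = ℤSolver.solve-∀
    ... | -[1+ m ] =
      conflict⁺ e₀ S ((1 , (form p ·x≤ k)) ∷ lowers α)
        ((1≤K , ≤k) ∷ All.map⁺ (All.map (λ {l} l∈ → 1≤K , lower l l∈) α-labels))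
        (≤-trans (s≤s (≤-reflexive (length-map _ α))) α<K)
        (λ i → trans (cong₂ (λ x y → + 1 ℤ.* x ℤ.+ y) (coeff-≤ p k i)
                            (trans (lowers-coeff α i) (α-sum i)))
                     (cancel (+ toBit (p i))))
        m (trans (cong (ℤ._+_ (+ 1 ℤ.* (ℤ.- k))) (lowers-bound α))
                 (trans (flip-sign k (+ trues α)) (cong ℤ.-_ k-s)))
      where
      lower : ∀ l → label l ∈ ineqs S → (unit (proj₁ l) ·x≥ + toBit (proj₂ l)) ∈ ineqs S
      lower (e , false) l∈ = lower∈ S e
      lower (e , true)  l∈ = l∈
      cancel : ∀ x → + 1 ℤ.* (ℤ.- x) ℤ.+ x ≡ + 0
      cancel = ℤSolver.solve-∀
      flip-sign : ∀ k s → + 1 ℤ.* (ℤ.- k) ℤ.+ s ≡ ℤ.- (k ℤ.- s)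
      flip-sign = ℤSolver.solve-∀

-- Counting and parity over lists.

sum-map-filter : (P? : Decidable P) (f : X → ℕ) → (∀ x → ¬ P x → f x ≡ 0) → ∀ xs →
                 sum (map f (filter P? xs)) ≡ sum (map f xs)
sum-map-filter P? f f≡0 []       = refl
sum-map-filter P? f f≡0 (x ∷ xs) with P? x
... | yes _  = cong (_+_ (f x)) (sum-map-filter P? f f≡0 xs)
... | no ¬px = trans (sum-map-filter P? f f≡0 xs) (cong (_+ sum (map f xs)) (sym (f≡0 x ¬px)))

length-filter≤sum : (P? : Decidable P) (f : X → ℕ) → (∀ x → P x → 1 ≤ f x) → ∀ xs →
                    length (filter P? xs) ≤ sum (map f xs)
length-filter≤sum P? f 1≤f []       = z≤n
length-filter≤sum P? f 1≤f (x ∷ xs) with P? x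
... | yes px = +-mono-≤ (1≤f x px) (length-filter≤sum P? f 1≤f xs)
... | no _   = m≤n⇒m≤o+n (f x) (length-filter≤sum P? f 1≤f xs)

length-filter≡sum : (P? : Decidable P) → ∀ xs →
                    length (filter P? xs) ≡ sum (map (λ x → toBit (does (P? x))) xs)
length-filter≡sum P? []       = refl
length-filter≡sum P? (x ∷ xs) with does (P? x)
... | true  = cong suc (length-filter≡sum P? xs)
... | false = length-filter≡sum P? xs

sum-map-+ : ∀ (f g : X → ℕ) xs → sum (map (λ x → f x + g x) xs) ≡ sum (map f xs) + sum (map g xs)
sum-map-+ f g []       = refl
sum-map-+ f g (x ∷ xs) = trans (cong (_+_ (f x + g x)) (sum-map-+ f g xs)) (interchange (f x) (g x) _ _)
  where
  interchange : ∀ a b c d → a + b + (c + d) ≡ a + c + (b + d)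
  interchange = ℕSolver.solve-∀

sum-map-const : ∀ {f : X → ℕ} {k} → (∀ x → f x ≡ k) → ∀ xs → sum (map f xs) ≡ length xs * k
sum-map-const f≡k []       = refl
sum-map-const f≡k (x ∷ xs) = cong₂ _+_ (f≡k x) (sum-map-const f≡k xs)

sum-map-swap : ∀ (f : X → Y → ℕ) xs ys →
               sum (map (λ x → sum (map (f x) ys)) xs) ≡ sum (map (λ y → sum (map (λ x → f x y) xs)) ys)
sum-map-swap f []       ys = sym (trans (sum-map-const (λ _ → refl) ys) (*-zeroʳ (length ys)))
sum-map-swap f (x ∷ xs) ys =
  trans (cong (_+_ (sum (map (f x) ys))) (sum-map-swap f xs ys)) (sym (sum-map-+ (f x) _ ys))

sum-subset : ∀ (s : Subset n) → sum (map (λ v → toBit (does (v ∈? s))) (allFin n)) ≡ Subset.∣ s ∣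
sum-subset s = trans (cong sum (map-tabulate id (λ v → toBit (does (v ∈? s))))) (go s)
  where
  go : ∀ {m} (s : Subset m) → sum (tabulate (λ v → toBit (does (v ∈? s)))) ≡ Subset.∣ s ∣
  go []          = refl
  go (false ∷ s) = go s
  go (true ∷ s)  = cong suc (go s)

parityOf : (X → Bool) → List X → Bool
parityOf q xs = odd (sum (map (toBit ∘ q) xs))

parityOf-++ : ∀ (q : X → Bool) xs ys → parityOf q (xs ++ ys) ≡ parityOf q xs xor parityOf q ys
parityOf-++ q xs ys = begin
  odd (sum (map (toBit ∘ q) (xs ++ ys)))                          ≡⟨ cong (odd ∘ sum) (map-++ (toBit ∘ q) xs ys) ⟩
  odd (sum (map (toBit ∘ q) xs ++ map (toBit ∘ q) ys))            ≡⟨ cong odd (sum-++ (map (toBit ∘ q) xs) _) ⟩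
  odd (sum (map (toBit ∘ q) xs) + sum (map (toBit ∘ q) ys))       ≡⟨ odd-+ (sum (map (toBit ∘ q) xs)) _ ⟩
  parityOf q xs xor parityOf q ys                                 ∎
  where open ≡-Reasoning

parityOf-[x] : ∀ (q : X → Bool) x → parityOf q (x ∷ []) ≡ q x
parityOf-[x] q x = trans (cong odd (+-identityʳ (toBit (q x)))) (odd-toBit (q x))

parityOf-filter : (P? : Decidable P) (q : X → Bool) → (∀ x → ¬ P x → q x ≡ false) → ∀ xs →
                  parityOf q (filter P? xs) ≡ parityOf q xs
parityOf-filter P? q q≡false xs = cong odd (sum-map-filter P? (toBit ∘ q) (λ x ¬px → cong toBit (q≡false x ¬px)) xs)

-- Size of the numbers in clause inequalities.

∣i+j∣≤1+k : ∀ i j {k} → ∣ i ∣ ≤ 1 → ∣ j ∣ ≤ k → ∣ i ℤ.+ j ∣ ≤ suc k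
∣i+j∣≤1+k i j i≤1 j≤k = ≤-trans (ℤ.∣i+j∣≤∣i∣+∣j∣ i j) (+-mono-≤ i≤1 j≤k)

-- Each literal changes any coefficient, and the bound, by at most 1, starting from 0 ≥ 1.
clauseIneq-small : ∀ (C : Clause n) → Small (suc (length C)) (clauseIneq C)
clauseIneq-small [] = (λ i → ≤-trans (≤-reflexive (cong ∣_∣ (lookup-replicate i (+ 0)))) z≤n) , ≤-refl
clauseIneq-small (pos e ∷ C) with clauseIneq C | clauseIneq-small C
... | c ·x≥ d | c≤ , d≤ =
  (λ i → subst (λ z → ∣ z ∣ ≤ _) (sym (lookup-suc e c i))
    (∣i+j∣≤1+k (lookup (unit e) i) (lookup c i) (unit-bits e i) (c≤ i))) ,
  m≤n⇒m≤1+n d≤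
clauseIneq-small (neg e ∷ C) with clauseIneq C | clauseIneq-small C
... | c ·x≥ d | c≤ , d≤ =
  (λ i → subst (λ z → ∣ z ∣ ≤ _) (sym (lookup-pred e c i))
    (∣i+j∣≤1+k (ℤ.- lookup (unit e) i) (lookup c i)
      (≤-trans (≤-reflexive (ℤ.∣-i∣≡∣i∣ (lookup (unit e) i))) (unit-bits e i)) (c≤ i))) ,
  ∣i+j∣≤1+k -[1+ 0 ] d ≤-refl d≤

-- Degrees and cuts.

length-incident≤ : ∀ G v → degree G v ≤ ∣E∣ G
length-incident≤ G v =
  ≤-trans (length-filter (λ e → v ∈? ends G e) (allFin (∣E∣ G))) (≤-reflexive (length-tabulate id))

length-assignment : ∀ (es : List (Fin n)) {α} → α ∈ assignments es → length α ≡ length es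
length-assignment es {α} α∈ = trans (sym (length-map proj₁ α)) (cong length (assignments-vars es α∈))

degree≤maxDegree : ∀ G v → degree G v ≤ maxDegree G
degree≤maxDegree G v =
  All.lookup (xs≤max 0 (map (degree G) (allFin (∣V∣ G)))) (∈-map⁺ (degree G) (∈-allFin v))

-- Double counting of incidences. It is used to bound the number of non-isolated vertices.
handshake : ∀ G → sum (map (degree G) (allFin (∣V∣ G))) ≡ ∣E∣ G * 2
handshake G = begin
  sum (map (degree G) (allFin (∣V∣ G)))
    ≡⟨ cong sum (map-cong (λ v → length-filter≡sum (λ e → v ∈? ends G e) (allFin (∣E∣ G))) (allFin (∣V∣ G))) ⟩
  sum (map (λ v → sum (map (λ e → toBit (does (v ∈? ends G e))) (allFin (∣E∣ G)))) (allFin (∣V∣ G)))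
    ≡⟨ sum-map-swap (λ v e → toBit (does (v ∈? ends G e))) (allFin (∣V∣ G)) (allFin (∣E∣ G)) ⟩
  sum (map (λ e → sum (map (λ v → toBit (does (v ∈? ends G e))) (allFin (∣V∣ G)))) (allFin (∣E∣ G)))
    ≡⟨ sum-map-const (λ e → trans (sum-subset (ends G e)) (ends-two G e)) (allFin (∣E∣ G)) ⟩
  length (allFin (∣E∣ G)) * 2
    ≡⟨ cong (_* 2) (length-tabulate {n = ∣E∣ G} id) ⟩
  ∣E∣ G * 2 ∎
  where open ≡-Reasoning

-- Counting endpoints modulo 2 makes the cut of a concatenation the `xor` of the cuts, which is the
-- hypothesis of `split`.
cut : (G : Graph) → List (Fin (∣V∣ G)) → Fin (∣E∣ G) → Bool
cut G W e = parityOf (λ v → does (v ∈? ends G e)) W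

-- Both ends of an edge lie in the list, and 2 is even.
cut-allFin : ∀ G e → cut G (allFin (∣V∣ G)) e ≡ false
cut-allFin G e = cong odd (trans (sum-subset (ends G e)) (ends-two G e))

isolated-edge : ∀ G v → degree G v ≡ 0 → ∀ e → does (v ∈? ends G e) ≡ false
isolated-edge G v deg≡0 e with v ∈? ends G e
... | no _    = refl
... | yes v∈e = contradiction (∈-filter⁺ (λ e → v ∈? ends G e) (∈-allFin e) v∈e) (∉[] (incident G v) deg≡0)
  where
  ∉[] : ∀ {e : Fin (∣E∣ G)} es → length es ≡ 0 → ¬ e ∈ es
  ∉[] [] _ ()

-- Inequalities of the encoded Tseitin formula.

tseitin-clause∈ : ∀ G ℓ v {α} → α ∈ assignments (incident G v) → parity α ≢ ℓ v →
                  clauseIneq (ruleOut α) ∈ encode (tseitin G ℓ)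
tseitin-clause∈ G ℓ v α∈ odd≢ =
  ∈-++⁺ʳ (boxIneqs (∣E∣ G)) (∈-map⁺ clauseIneq (∈-concatMap⁺ (vertexClauses G ℓ) (lose (∈-allFin v)
    (∈-map⁺ ruleOut (∈-filter⁺ (λ α → ¬? (parity α ≟ᵇ ℓ v)) α∈ odd≢)))))

box-small : ∀ n {I : LinIneq n} → I ∈ boxIneqs n → Small 1 I
box-small n I∈ with satisfied (∈-concatMap⁻ _ {xs = allFin n} I∈)
... | e , here refl         = unit-bits e , z≤n
... | e , there (here refl) =
  (λ i → ≤-trans (≤-reflexive (trans (cong ∣_∣ (lookup-map i ℤ.-_ (unit e))) (ℤ.∣-i∣≡∣i∣ (lookup (unit e) i))))
                 (unit-bits e i)) ,
  ≤-refl

small-mono : ∀ {K L} (I : LinIneq n) → K ≤ L → Small K I → Small L I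
small-mono I K≤L (c≤K , d≤K) = (λ i → ≤-trans (c≤K i) K≤L) , ≤-trans d≤K K≤L

tseitin-small : ∀ G ℓ {I} → I ∈ encode (tseitin G ℓ) → Small (suc (∣E∣ G)) I
tseitin-small G ℓ {I} I∈ with ∈-++⁻ (boxIneqs (∣E∣ G)) I∈
... | inj₁ I∈box = small-mono I (s≤s z≤n) (box-small (∣E∣ G) I∈box)
... | inj₂ I∈clauses with ∈-map⁻ clauseIneq I∈clauses
...   | C , C∈ , refl with satisfied (∈-concatMap⁻ (vertexClauses G ℓ) {xs = allFin (∣V∣ G)} C∈)
...     | v , C∈v with ∈-map⁻ ruleOut C∈v
...       | α , α∈ , refl = small-mono (clauseIneq (ruleOut α)) (s≤s length≤) (clauseIneq-small (ruleOut α))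
  where
  length≤ : length (ruleOut α) ≤ ∣E∣ G
  length≤ = begin
    length (ruleOut α)    ≡⟨ length-map _ α ⟩
    length α              ≡⟨ length-assignment (incident G v) (proj₁ (∈-filter⁻ (λ α → ¬? (parity α ≟ᵇ ℓ v)) α∈)) ⟩
    degree G v            ≤⟨ length-incident≤ G v ⟩
    ∣E∣ G                 ∎
    where open ≤-Reasoning

-- Divide and conquer on the vertices.

module Conquer (G : Graph) (ℓ : Labelling G) (J K c : ℕ) (4≤K : 4 ≤ K)
               (cost : suc ((2 + K) * (K * (K * K) + 3 + suc (∣E∣ G) * (2 + K))) ≤ c)
               (n<2^J : ∣E∣ G < 2 ^ J) (2^J<K : 2 ^ J < K) where

  open Calculus (encode (tseitin G ℓ)) (∈-++⁺ˡ {xs = boxIneqs (∣E∣ G)}) K c 4≤K cost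

  root : System
  root = record { ineqs = encode (tseitin G ℓ)
                ; base⊆ = id
                ; small = λ {I} I∈ → small-mono I (≤-trans n<2^J (<⇒≤ 2^J<K)) (tseitin-small G ℓ I∈) }

  assignment<K : ∀ v {α} → α ∈ assignments (incident G v) → length α < K
  assignment<K v α∈ = ≤-<-trans
    (≤-trans (≤-reflexive (length-assignment (incident G v) α∈)) (length-incident≤ G v))
    (<-trans n<2^J 2^J<K)

  -- The equation of such a vertex is 0 = 1, encoded by the empty clause, so a single leaf suffices.
  conflict-isolated : ∀ v → degree G v ≡ 0 → ℓ v ≡ true → root ⊢ 0
  conflict-isolated v deg≡0 ℓv =
    conflict-clause root [] (≤-trans (s≤s z≤n) 4≤K)
      (tseitin-clause∈ G ℓ v (go (incident G v) deg≡0) (λ false≡ℓv → contradiction (trans false≡ℓv ℓv) λ ())) []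
    where
    go : ∀ (es : List (Fin (∣E∣ G))) → length es ≡ 0 → [] ∈ assignments es
    go [] _ = here refl

  module _ (e₀ : Fin (∣E∣ G)) where

    open Search e₀ J n<2^J 2^J<K

    conflict-vertex : ∀ v k S → Value S (cut G (v ∷ [])) k → oddℤ k ≢ ℓ v → S ⊢ maxDegree G
    conflict-vertex v k S value odd≢ =
      -- Branching uses `degree G v` of the allowed depth. The rest goes to the leaves, whose depth
      -- bound is arbitrary.
      subst (S ⊢_) (m+[n∸m]≡n (degree≤maxDegree G v))
        (branch (incident G v) S λ α T α∈ S≼T α-labels → close α T α∈ S≼T α-labels (parity α ≟ᵇ ℓ v))
      where
      α-sum : ∀ {α} → α ∈ assignments (incident G v) → ∀ i →
              ∑-units (map proj₁ α) i ≡ + toBit (cut G (v ∷ []) i)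
      α-sum {α} α∈ i = begin
        ∑-units (map proj₁ α) i              ≡⟨ cong (λ es → ∑-units es i) (assignments-vars (incident G v) α∈) ⟩
        ∑-units (incident G v) i             ≡⟨ ∑-units-filter-allFin (λ e → v ∈? ends G e) i ⟩
        + toBit (does (v ∈? ends G i))       ≡⟨ cong (λ b → + toBit b) (parityOf-[x] (λ v → does (v ∈? ends G i)) v) ⟨
        + toBit (cut G (v ∷ []) i)           ∎
        where open ≡-Reasoning
      close : ∀ α T → α ∈ assignments (incident G v) → S ≼ T → All (λ l → label l ∈ ineqs T) α →
              Dec (parity α ≡ ℓ v) → T ⊢ maxDegree G ∸ degree G v
      close α T α∈ S≼T α-labels (no ≢ℓv)  =
        conflict-clause T α (assignment<K v α∈) (base⊆ T (tseitin-clause∈ G ℓ v α∈ ≢ℓv)) α-labels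
      close α T α∈ S≼T α-labels (yes ≡ℓv) =
        conflict-parity T (cut G (v ∷ [])) k α (weaken {S = S} {T = T} S≼T value) (α-sum α∈) (assignment<K v α∈)
          α-labels (λ odd≡ → odd≢ (trans odd≡ ≡ℓv))

    -- Values grow by at most 3 · 2^J per level, so the hypothesis on `K` reserves this amount for
    -- each of the `j` remaining levels.
    conquer : ∀ j W k S → length W ≤ 2 ^ j → 2 + (∣ k ∣ + j * (3 * 2 ^ J)) ≤ K →
              Value S (cut G W) k → oddℤ k ≢ parityOf ℓ W → S ⊢ j * (6 + 2 * J) + maxDegree G
    -- The second half is empty when the list is short. Its cut is empty too, so the empty
    -- assignment shows the sum to be 0, which has the parity of the empty label sum.
    conquer zero []       k S _ k≤ value odd≢ =
      conflict-parity S (cut G []) k [] value (λ _ → refl) (≤-trans (s≤s z≤n) 4≤K) [] odd≢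
    conquer zero (v ∷ []) k S _ k≤ value odd≢ =
      conflict-vertex v k S value (λ odd≡ → odd≢ (trans odd≡ (sym (parityOf-[x] ℓ v))))
    conquer zero (v ∷ w ∷ W) k S (s≤s ()) k≤ value odd≢
    conquer (suc j) W k S W≤ k≤ value odd≢ =
      subst (S ⊢_) (sym (+-assoc (6 + 2 * J) (j * (6 + 2 * J)) (maxDegree G)))
        (split S (cut G W₁) (cut G W₂) (cut G W) cut≡ k value
          (≤-trans (s≤s (s≤s (+-monoʳ-≤ ∣ k ∣ (m≤m+n (3 * 2 ^ J) _)))) k≤) recurse)
      where
      W₁ W₂ : List (Fin (∣V∣ G))
      W₁ = take (2 ^ j) W
      W₂ = drop (2 ^ j) W
      parity-split : ∀ q → parityOf q W ≡ parityOf q W₁ xor parityOf q W₂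
      parity-split q = trans (cong (parityOf q) (sym (take++drop≡id (2 ^ j) W))) (parityOf-++ q W₁ W₂)
      cut≡ : ∀ e → cut G W e ≡ cut G W₁ e xor cut G W₂ e
      cut≡ e = parity-split (λ v → does (v ∈? ends G e))
      W₁≤ : length W₁ ≤ 2 ^ j
      W₁≤ = ≤-trans (≤-reflexive (length-take (2 ^ j) W)) (m⊓n≤m (2 ^ j) (length W))
      W₂≤ : length W₂ ≤ 2 ^ j
      W₂≤ = begin
        length W₂               ≡⟨ length-drop (2 ^ j) W ⟩
        length W ∸ 2 ^ j        ≤⟨ ∸-monoˡ-≤ (2 ^ j) W≤ ⟩
        2 ^ suc j ∸ 2 ^ j       ≡⟨ m+n∸m≡n (2 ^ j) (2 ^ j + 0) ⟩
        2 ^ j + 0               ≡⟨ +-identityʳ (2 ^ j) ⟩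
        2 ^ j                   ∎
        where open ≤-Reasoning
      budget : ∀ a → ∣ a ∣ ≤ ∣ k ∣ + 3 * 2 ^ J → 2 + (∣ a ∣ + j * (3 * 2 ^ J)) ≤ K
      budget a a≤ = ≤-trans (s≤s (s≤s (≤-trans (+-monoˡ-≤ (j * (3 * 2 ^ J)) a≤)
        (≤-reflexive (+-assoc ∣ k ∣ (3 * 2 ^ J) (j * (3 * 2 ^ J))))))) k≤
      recurse : ∀ a b T → oddℤ k ≡ oddℤ a xor oddℤ b →
                ∣ a ∣ ≤ ∣ k ∣ + 3 * 2 ^ J → ∣ b ∣ ≤ ∣ k ∣ + 3 * 2 ^ J →
                Value T (cut G W₁) a → Value T (cut G W₂) b → T ⊢ j * (6 + 2 * J) + maxDegree G
      -- If both halves had the right parity, so would their concatenation.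
      recurse a b T odd≡ a≤ b≤ value₁ value₂ with oddℤ a ≟ᵇ parityOf ℓ W₁
      ... | no odd₁≢   = conquer j W₁ a T W₁≤ (budget a a≤) value₁ odd₁≢
      ... | yes odd₁≡  = conquer j W₂ b T W₂≤ (budget b b≤) value₂ λ odd₂≡ →
        odd≢ (trans odd≡ (trans (cong₂ _xor_ odd₁≡ odd₂≡) (sym (parity-split ℓ))))

    -- Isolated vertices are dropped because the number of edges does not bound
    -- how many there are.
    refute : parityOf ℓ (allFin (∣V∣ G)) ≡ true → (∀ v → degree G v ≡ 0 → ℓ v ≡ false) →
             2 + suc J * (3 * 2 ^ J) ≤ K → root ⊢ 2 + (suc J * (6 + 2 * J) + maxDegree G)
    refute odd-ℓ isolated-ℓ K-large =
      pin-zero root (cut G V) cut≡0 λ T _ value →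
        conquer (suc J) V (+ 0) T V≤ K-large value
          (λ false≡ → contradiction (trans false≡ odd-V) λ ())
      where
      0<deg? : Decidable (λ v → 0 < degree G v)
      0<deg? v = 0 <? degree G v
      V : List (Fin (∣V∣ G))
      V = filter 0<deg? (allFin (∣V∣ G))
      odd-V : parityOf ℓ V ≡ true
      odd-V = trans
        (parityOf-filter 0<deg? ℓ (λ v ¬0< → isolated-ℓ v (n≤0⇒n≡0 (≮⇒≥ ¬0<))) (allFin (∣V∣ G))) odd-ℓ
      -- Isolated vertices lie on no edge, so dropping them leaves the cut of the full vertex list
      -- unchanged.
      cut≡0 : ∀ e → cut G V e ≡ false
      cut≡0 e = trans
        (parityOf-filter 0<deg? (λ v → does (v ∈? ends G e))
          (λ v ¬0< → isolated-edge G v (n≤0⇒n≡0 (≮⇒≥ ¬0<)) e) (allFin (∣V∣ G)))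
        (cut-allFin G e)
      -- Every vertex of `V` contributes at least 1 to the degree sum 2n; the factor 2 is why
      -- `suc J` levels are needed.
      V≤ : length V ≤ 2 ^ suc J
      V≤ = begin
        length V                                  ≤⟨ length-filter≤sum 0<deg? (degree G) (λ _ 0< → 0<) (allFin (∣V∣ G)) ⟩
        sum (map (degree G) (allFin (∣V∣ G)))     ≡⟨ handshake G ⟩
        ∣E∣ G * 2                                 ≡⟨ *-comm (∣E∣ G) 2 ⟩
        2 * ∣E∣ G                                 ≤⟨ *-monoʳ-≤ 2 (<⇒≤ n<2^J) ⟩
        2 ^ suc J                                 ∎
        where open ≤-Reasoning

-- Witnesses extracted from lists.

parityOf-true : ∀ (q : X → Bool) xs → parityOf q xs ≡ true → ∃[ x ] q x ≡ true
parityOf-true q (x ∷ xs) odd≡ with q x in qx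
... | true  = x , qx
... | false = parityOf-true q xs odd≡

element : (xs : List X) → length xs ≢ 0 → X
element []      len≢0 = contradiction refl len≢0
element (x ∷ _) _     = x

-- Choice of the numerical parameters.

-- Bounding 2 + K by 2K and 3 by K³ makes the product at most 2K · 4K³ = 8K⁴. Another 8K⁴ absorbs
-- the leading 1 and keeps the constant a power of two.
leaf-cost : ∀ {m K} → suc m ≤ K → 4 ≤ K →
            suc ((2 + K) * (K * (K * K) + 3 + suc m * (2 + K))) ≤ 2 ^ 4 * K ^ 4
leaf-cost {m} {K} m<K 4≤K = begin
  suc ((2 + K) * (K * (K * K) + 3 + suc m * (2 + K)))
    ≤⟨ s≤s (*-mono-≤ 2+K≤2K (+-mono-≤ (+-monoʳ-≤ (K * (K * K)) 3≤K³) mK≤2K³)) ⟩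
  1 + 2 * K * (K * (K * K) + K * (K * K) + K * (2 * (K * K)))
    ≤⟨ +-monoˡ-≤ _ 1≤8K⁴ ⟩
  8 * K * (K * (K * K)) + 2 * K * (K * (K * K) + K * (K * K) + K * (2 * (K * K)))
    ≡⟨ collect K ⟩
  16 * (K * (K * (K * (K * 1)))) ∎
  where
  open ≤-Reasoning
  1≤K : 1 ≤ K
  1≤K = ≤-trans (s≤s z≤n) 4≤K
  2+K≤2K : 2 + K ≤ 2 * K
  2+K≤2K = ≤-trans (+-monoˡ-≤ K (≤-trans (s≤s (s≤s z≤n)) 4≤K)) (≤-reflexive (cong (_+_ K) (sym (+-identityʳ K))))
  3≤K³ : 3 ≤ K * (K * K)
  3≤K³ = *-mono-≤ (≤-trans (n≤1+n 3) 4≤K) (*-mono-≤ 1≤K 1≤K)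
  mK≤2K³ : suc m * (2 + K) ≤ K * (2 * (K * K))
  mK≤2K³ = *-mono-≤ m<K (≤-trans 2+K≤2K (*-monoʳ-≤ 2 (≤-trans (≤-reflexive (sym (*-identityʳ K))) (*-monoʳ-≤ K 1≤K))))
  1≤8K⁴ : 1 ≤ 8 * K * (K * (K * K))
  1≤8K⁴ = *-mono-≤ (*-mono-≤ {1} {8} (s≤s z≤n) 1≤K) (*-mono-≤ 1≤K (*-mono-≤ 1≤K 1≤K))
  collect : ∀ k → 8 * k * (k * (k * k)) + 2 * k * (k * (k * k) + k * (k * k) + k * (2 * (k * k)))
                ≡ 16 * (k * (k * (k * (k * 1))))
  collect = ℕSolver.solve-∀

-- With M = 2^J, both 1 and J + 1 are at most M, so the left side is at most 5M², which is rounded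
-- up to 8M².
budget-bound : ∀ J → 2 + suc J * (3 * 2 ^ J) ≤ 2 ^ (3 + 2 * J)
budget-bound J = begin
  2 + suc J * (3 * M)        ≤⟨ +-mono-≤ (*-monoʳ-≤ 2 (*-mono-≤ 1≤M 1≤M)) (*-monoˡ-≤ (3 * M) (m<2^m J)) ⟩
  2 * (M * M) + M * (3 * M)  ≤⟨ m≤m+n _ (3 * (M * M)) ⟩
  2 * (M * M) + M * (3 * M) + 3 * (M * M) ≡⟨ collect M ⟩
  2 ^ 3 * (M * M)            ≡⟨ cong (_*_ (2 ^ 3)) (^-distribˡ-+-* 2 J J) ⟨
  2 ^ 3 * 2 ^ (J + J)        ≡⟨ cong (λ i → 2 ^ 3 * 2 ^ (J + i)) (+-identityʳ J) ⟨
  2 ^ 3 * 2 ^ (2 * J)        ≡⟨ ^-distribˡ-+-* 2 3 (2 * J) ⟨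
  2 ^ (3 + 2 * J)            ∎
  where
  open ≤-Reasoning
  M : ℕ
  M = 2 ^ J
  1≤M : 1 ≤ M
  1≤M = m^n>0 2 J
  collect : ∀ m → 2 * (m * m) + m * (3 * m) + 3 * (m * m) ≡ 8 * (m * m)
  collect = ℕSolver.solve-∀

4≤2^[3+2J] : ∀ J → 4 ≤ 2 ^ (3 + 2 * J)
4≤2^[3+2J] J = ^-monoʳ-≤ 2 {2} {3 + 2 * J} (m≤m+n 2 (1 + 2 * J))

2^J<2^[3+2J] : ∀ J → 2 ^ J < 2 ^ (3 + 2 * J)
2^J<2^[3+2J] J = ^-monoʳ-< 2 ≤-refl {J} {3 + 2 * J} (s≤s (≤-trans (m≤m+n J (J + 0)) (m≤n+m (2 * J) 2)))

2^4*[2^k]^4 : ∀ k → 2 ^ 4 * (2 ^ k) ^ 4 ≡ 2 ^ (4 + k * 4)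
2^4*[2^k]^4 k = trans (cong (_*_ (2 ^ 4)) (^-*-assoc 2 k 4)) (sym (^-distribˡ-+-* 2 4 (k * 4)))

-- The bounds enter the construction only through these fields: conversion
-- checking would otherwise unfold powers of 2 whose exponents start with numerals.
record Parameters (m J : ℕ) : Set where
  field
    K c E  : ℕ
    4≤K    : 4 ≤ K
    2^J<K  : 2 ^ J < K
    budget : 2 + suc J * (3 * 2 ^ J) ≤ K
    cost   : suc ((2 + K) * (K * (K * K) + 3 + suc m * (2 + K))) ≤ c
    c≡2^E  : c ≡ 2 ^ E
    E≡     : E ≡ 4 + (3 + 2 * J) * 4

parameters : ∀ {m} J → m < 2 ^ J → Parameters m J
parameters J m<2^J = record
  { K      = 2 ^ (3 + 2 * J)
  ; c      = 2 ^ 4 * (2 ^ (3 + 2 * J)) ^ 4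
  ; 4≤K    = 4≤2^[3+2J] J
  ; 2^J<K  = 2^J<2^[3+2J] J
  ; budget = budget-bound J
  ; cost   = leaf-cost (≤-trans m<2^J (<⇒≤ (2^J<2^[3+2J] J))) (4≤2^[3+2J] J)
  ; E      = 4 + (3 + 2 * J) * 4
  ; c≡2^E  = 2^4*[2^k]^4 (3 + 2 * J)
  ; E≡     = refl
  }

-- Asymptotic bounds.

searchBits : ℕ → ℕ
searchBits n = suc ⌊log₂ n ⌋

-- The product counts `suc J` levels of 6 + 2J queries. The 3 covers the two queries of `pin-zero`
-- and the successor in the exponent `suc D` of `Refutes`.
depthFactor : ℕ → ℕ
depthFactor n = 3 + suc (searchBits n) * (6 + 2 * searchBits n)

sizeExponent : ℕ → ℕ
sizeExponent n = 4 + (3 + 2 * searchBits n) * 4 + depthFactor n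

-- From n = 2 on the logarithm is positive, so lower-order terms of a quadratic polynomial in it are
-- absorbed by its square.
∈O-log² : ∀ {f : ℕ → ℕ} (g : ℕ → ℕ) C → (∀ n → f n ≡ g ⌊log₂ n ⌋) →
          (∀ x → g (suc x) ≤ C * suc x ^ 2) → f ∈O log²
∈O-log² {f} g C f≡g g≤ = C , 2 , λ n 2≤n → bounded n (subst (_≤ ⌊log₂ n ⌋) (⌊log₂[2^n]⌋≡n 1) (⌊log₂⌋-mono-≤ 2≤n))
  where
  bounded : ∀ n → 1 ≤ ⌊log₂ n ⌋ → f n ≤ C * log² n
  bounded n 1≤log rewrite f≡g n with suc x ← ⌊log₂ n ⌋ = g≤ x

depthFactor∈O : depthFactor ∈O log²
-- The constant 33 is the sum of the coefficients of the polynomial, that is, its value at l = 1.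
depthFactor∈O = ∈O-log² (λ l → 3 + (2 + l) * (6 + 2 * suc l)) 33 (λ _ → refl)
  λ x → ≤-trans (m≤m+n _ (31 * (x * x) + 50 * x)) (≤-reflexive (expand x))
  where
  expand : ∀ x → 3 + (2 + suc x) * (6 + 2 * suc (suc x)) + (31 * (x * x) + 50 * x) ≡ 33 * (suc x * (suc x * 1))
  expand = ℕSolver.solve-∀

sizeExponent∈O : sizeExponent ∈O log²
-- Again 65 is the value at l = 1.
sizeExponent∈O = ∈O-log² (λ l → 4 + (3 + 2 * suc l) * 4 + (3 + (2 + l) * (6 + 2 * suc l))) 65 (λ _ → refl)
  λ x → ≤-trans (m≤m+n _ (63 * (x * x) + 106 * x)) (≤-reflexive (expand x))
  where
  expand : ∀ x → 4 + (3 + 2 * suc (suc x)) * 4 + (3 + (2 + suc x) * (6 + 2 * suc (suc x))) + (63 * (x * x) + 106 * x)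
               ≡ 65 * (suc x * (suc x * 1))
  expand = ℕSolver.solve-∀

size-bound : ∀ {m c D E F H} → c ≡ 2 ^ E → m + c ≤ c * 2 ^ suc D → suc D ≤ F → E + F ≡ H → m ≤ 2 ^ H
size-bound {m} {c} {D} {E} {F} refl m+c≤ 1+D≤F refl = begin
  m                  ≤⟨ m≤m+n m c ⟩
  m + c              ≤⟨ m+c≤ ⟩
  2 ^ E * 2 ^ suc D  ≤⟨ *-monoʳ-≤ (2 ^ E) (^-monoʳ-≤ 2 {suc D} {F} 1+D≤F) ⟩
  2 ^ E * 2 ^ F      ≡⟨ ^-distribˡ-+-* 2 E F ⟨
  2 ^ (E + F)        ∎
  where open ≤-Reasoning

refutes⇒bounds : ∀ c E F H N → c ≡ 2 ^ E → E + F ≡ H → ∀ D → suc D ≤ F → D ≤ N →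
                 Refutes c D A → Σ[ P ∈ SP A ] (size P ≤ 2 ^ H) × (depth P ≤ N)
refutes⇒bounds c E F H N c≡ E+F≡H D D<F D≤N (P , depth≤ , size≤) =
  P , size-bound {D = D} {E = E} {F = F} c≡ size≤ D<F E+F≡H , ≤-trans depth≤ D≤N

-- The final branching adds the degree to the depth of the levels; for a positive degree the product
-- absorbs this summand.
depth-bound : ∀ x {d} → 1 ≤ d → 2 + (x + d) ≤ d * (3 + x)
depth-bound x {suc d} _ = begin
  2 + (x + suc d)            ≡⟨ cong (_+_ 2) (+-suc x d) ⟩
  3 + x + d                  ≤⟨ +-monoʳ-≤ (3 + x) (m≤m*n d (3 + x)) ⟩
  3 + x + d * (3 + x)        ∎
  where open ≤-Reasoning

-- The refutation and its bounds.

refutation : (G : Graph) (ℓ : Labelling G) → OddSum G ℓ → Parameters (∣E∣ G) (searchBits (∣E∣ G)) →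
             Σ[ P ∈ SP (encode (tseitin G ℓ)) ]
             (size P ≤ 2 ^ (sizeExponent (∣E∣ G) + maxDegree G)) ×
             (depth P ≤ maxDegree G * depthFactor (∣E∣ G))
refutation G ℓ odd-sum params = by-isolated (any? λ v → (degree G v ≟ 0) ×-dec (ℓ v ≟ᵇ true))
  where
  open Parameters params
  J levels : ℕ
  J = searchBits (∣E∣ G)
  levels = suc J * (6 + 2 * J)
  open Conquer G ℓ J K c 4≤K cost (m<2^[1+⌊log₂m⌋] (∣E∣ G)) 2^J<K
  odd-ℓ : parityOf ℓ (allFin (∣V∣ G)) ≡ true
  odd-ℓ = %2≡1⇒odd (sum (map (toBit ∘ ℓ) (allFin (∣V∣ G)))) odd-sum
  Result : Set
  Result = Σ[ P ∈ SP (encode (tseitin G ℓ)) ]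
           (size P ≤ 2 ^ (sizeExponent (∣E∣ G) + maxDegree G)) ×
           (depth P ≤ maxDegree G * depthFactor (∣E∣ G))
  exponent≡ : E + (3 + levels + maxDegree G) ≡ sizeExponent (∣E∣ G) + maxDegree G
  exponent≡ = trans (cong (_+ (3 + levels + maxDegree G)) E≡) (sym (+-assoc (4 + (3 + 2 * J) * 4) (3 + levels) (maxDegree G)))
  conclude : ∀ D → D ≤ 2 + (levels + maxDegree G) → D ≤ maxDegree G * depthFactor (∣E∣ G) →
             Refutes c D (encode (tseitin G ℓ)) → Result
  conclude D D≤F = refutes⇒bounds c E (3 + levels + maxDegree G)
    (sizeExponent (∣E∣ G) + maxDegree G) (maxDegree G * depthFactor (∣E∣ G)) c≡2^E exponent≡ D (s≤s D≤F)
  by-isolated : Dec (∃[ v ] degree G v ≡ 0 × ℓ v ≡ true) → Result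
  -- A refutation of depth 0 meets the depth bound even when the maximum degree is 0.
  by-isolated (yes (v , deg≡0 , ℓv)) = conclude 0 z≤n z≤n (conflict-isolated v deg≡0 ℓv)
  by-isolated (no ¬isolated) =
    -- Some vertex has label 1 and is not isolated in this case; it makes the maximum degree
    -- positive and supplies the edge `e₀`.
    let v , ℓv = parityOf-true ℓ (allFin (∣V∣ G)) odd-ℓ
        deg≢0 = λ deg≡0 → ¬isolated (v , deg≡0 , ℓv)
        1≤maxDegree = ≤-trans (n≢0⇒n>0 deg≢0) (degree≤maxDegree G v)
    in
    conclude (2 + (levels + maxDegree G)) ≤-refl (depth-bound levels {maxDegree G} 1≤maxDegree)
      (refute (element (incident G v) deg≢0) odd-ℓ (λ u deg≡0 → ¬-not λ ℓu → ¬isolated (u , deg≡0 , ℓu)) budget)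

theorem3p1 : ∃[ s ] ∃[ t ] (s ∈O log²) × (t ∈O log²) ×
    ((G : Graph) (ℓ : Labelling G) → OddSum G ℓ →
    Σ[ P ∈ SP (encode (tseitin G ℓ)) ]
    (size P ≤ 2 ^ (s (∣E∣ G) + maxDegree G)) ×
    (depth P ≤ maxDegree G * t (∣E∣ G)))
theorem3p1 = sizeExponent , depthFactor , sizeExponent∈O , depthFactor∈O , λ G ℓ odd-sum →
  refutation G ℓ odd-sum (parameters (searchBits (∣E∣ G)) (m<2^[1+⌊log₂m⌋] (∣E∣ G)))
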